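{- Let $x_1,x_2,y_1,y_2,u_1,u_2,v_1,v_2,p_{+1},p_{+2},p_{ -1},p_{ -2},q_{+1},q_{+2},q_{ -1},q_{ -2},s,\lambda$ and $\mathbf{w}=(w_\ell)_{\ell\ge0}$ be commuting indeterminates, and for $n\ge0$ let \[ \widehat{Q}_n=\sum_{\sigma\in\mathfrak{S}_n} x_1^{\mathrm{eareccpeak}}x_2^{\mathrm{eareccdfall}}y_1^{\mathrm{ereccval}}y_2^{\mathrm{ereccdrise}}u_1^{\mathrm{nrcpeak}}u_2^{\mathrm{nrcdfall}}v_1^{\mathrm{nrcval}}v_2^{\mathrm{nrcdrise}}\Big(\prod_{i\in\mathrm{Fix}(\sigma)}w_{\mathrm{psnest}(i,\sigma)}\Big) p_{+1}^{\mathrm{ucrosscval}}p_{+2}^{\mathrm{ucrosscdrise}}p_{ -1}^{\mathrm{lcrosscpeak}}p_{ -2}^{\mathrm{lcrosscdfall}}q_{+1}^{\mathrm{unestcval}}q_{+2}^{\mathrm{unestcdrise}}q_{ -1}^{\mathrm{lnestcpeak}}q_{ -2}^{\mathrm{lnestcdfall}}s^{\mathrm{psnest}}\lambda^{\mathrm{cyc}}, \] all statistics evaluated at $\sigma$. Under the specialisation $v_1=y_1$ and $q_{+1}=p_{+1}$, the ordinary generating function $\sum_{n\ge0}\widehat{Q}_n t^n$ equals the J-fraction \[ \cfrac{1}{1-\gamma_0t-\cfrac{\beta_1t^2}{1-\gamma_1t-\cfrac{\beta_2t^2}{1-\cdots}}} \] with $\gamma_0=\lambda w_0$, $\gamma_n=\big(p_{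 -2}^{n-1}x_2+q_{ -2}[n-1]_{p_{ -2},q_{ -2}}u_2\big)+\big(p_{+2}^{n-1}y_2+q_{+2}[n-1]_{p_{+2},q_{+2}}v_2\big)+\lambda s^nw_n$ for $n\ge1$, and $\beta_n=(\lambda+n-1)\big(p_{ -1}^{n-1}x_1+q_{ -1}[n-1]_{p_{ -1},q_{ -1}}u_1\big)p_{+1}^{n-1}y_1$ for $n\ge1$.
   Context: $\mathfrak{S}_n$ is the set of permutations of $[n]$. For $\sigma\in\mathfrak{S}_n$, an index $i$ is a cycle peak if $\sigma^{ -1}(i)<i>\sigma(i)$, cycle valley if $\sigma^{ -1}(i)>i<\sigma(i)$, cycle double rise if $\sigma^{ -1}(i)<i<\sigma(i)$, cycle double fall if $\sigma^{ -1}(i)>i>\sigma(i)$, fixed point if $\sigma(i)=i$ ($\mathrm{Fix}(\sigma)$ = set of fixed points). Index $i$ is a record if $\sigma(j)<\sigma(i)$ for all $j<i$, an antirecord if $\sigma(j)>\sigma(i)$ for all $j>i$; exclusive record = record and not antirecord; exclusive antirecord = antirecord and not record. $\mathrm{eareccpeak}$, $\mathrm{eareccdfall}$ count cycle peaks, cycle double falls that are exclusive antirecords; $\mathrm{ereccval}$, $\mathrm{ereccdrise}$ count cycle valleys, cycle double rises that are exclusive records; $\mathrm{nrcpeak},\mathrm{nrcdfall},\mathrm{nrcval},\mathrm{nrcdrise}$ count cycle peaks, double falls, valleys, double rises that are neither records nor antirecords. $\mathrm{psnest}(i,\sigma)=\#\{j<i:\sigma(j)>i\}$ and $\mathrm{psnest}(\sigma)=\sum_{i\in\mathrm{Fix}(\sigma)}\mathrm{psnest}(i,\sigma)$.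 $\mathrm{cyc}(\sigma)$ = number of cycles. Index-refined statistics: $\mathrm{ucross}(j,\sigma)=\#\{(i,k,l): i<j<k<l,\ k=\sigma(i),\ l=\sigma(j)\}$, $\mathrm{unest}(j,\sigma)=\#\{(i,k,l):i<j<k<l,\ k=\sigma(j),\ l=\sigma(i)\}$, $\mathrm{lcross}(k,\sigma)=\#\{(i,j,l):i<j<k<l,\ i=\sigma(k),\ j=\sigma(l)\}$, $\mathrm{lnest}(k,\sigma)=\#\{(i,j,l):i<j<k<l,\ i=\sigma(l),\ j=\sigma(k)\}$. Then $\mathrm{ucrosscval}(\sigma)=\sum_{j\text{ cycle valley}}\mathrm{ucross}(j,\sigma)$, $\mathrm{ucrosscdrise}(\sigma)=\sum_{j\text{ cycle double rise}}\mathrm{ucross}(j,\sigma)$, $\mathrm{unestcval},\mathrm{unestcdrise}$ analogously with $\mathrm{unest}$; $\mathrm{lcrosscpeak}(\sigma)=\sum_{k\text{ cycle peak}}\mathrm{lcross}(k,\sigma)$, $\mathrm{lcrosscdfall}(\sigma)=\sum_{k\text{ cycle double fall}}\mathrm{lcross}(k,\sigma)$, and $\mathrm{lnestcpeak},\mathrm{lnestcdfall}$ analogously with $\mathrm{lnest}$. $[m]_{p,q}=\sum_{j=0}^{m-1}p^{m-1-j}q^j$. -}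

module Defs where

open import Level using (Level)
open import Algebra.Bundles using (CommutativeRing)
open import Data.Nat.Base using (ℕ; zero; suc; _∸_; _<ᵇ_; _≤ᵇ_; _≡ᵇ_)
open import Data.Bool.Base using (Bool; true; false; _∧_; _∨_; not; if_then_else_)
open import Data.List.Base using (List; []; _∷_; length; map; foldr; upTo; concatMap)

-- Permutations of [n] = {1,…,n}, represented in one-line notation as
-- words σ(1) σ(2) … σ(n) (a list of length n) with entries in [n],
-- pairwise distinct.

range : ℕ → List ℕ
range n = map suc (upTo n)

count : (ℕ → Bool) → List ℕ → ℕ
count p = foldr (λ x c → if p x then suc c else c) 0

allB : (ℕ → Bool) → List ℕ → Bool
allB p = foldr (λ x b → p x ∧ b) true

anyB : (ℕ → Bool) → List ℕ → Bool
anyB p = foldr (λ x b → p x ∨ b) false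

filterB : {A : Set} → (A → Bool) → List A → List A
filterB p [] = []
filterB p (x ∷ xs) = if p x then x ∷ filterB p xs else filterB p xs

distinctB : List ℕ → Bool
distinctB [] = true
distinctB (x ∷ xs) = not (anyB (λ y → x ≡ᵇ y) xs) ∧ distinctB xs

words : ℕ → ℕ → List (List ℕ)
words n zero = [] ∷ []
words n (suc k) = concatMap (λ v → map (v ∷_) (words n k)) (range n)

perms : ℕ → List (List ℕ)
perms n = filterB distinctB (words n n)

-- σ(i) for 1 ≤ i ≤ n (1-based lookup)
at : List ℕ → ℕ → ℕ
at [] _ = 0
at (x ∷ xs) zero = 0
at (x ∷ xs) (suc zero) = x
at (x ∷ xs) (suc (suc i)) = at xs (suc i)

-- σ⁻¹(v): 1-based position of v
posOf : ℕ → List ℕ → ℕ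
posOf v [] = 0
posOf v (x ∷ xs) = if x ≡ᵇ v then 1 else suc (posOf v xs)

module _ (σ : List ℕ) where

  private
    n : ℕ
    n = length σ
    S : ℕ → ℕ
    S = at σ
    Sinv : ℕ → ℕ
    Sinv v = posOf v σ

  isCPeak isCVal isCDRise isCDFall isFix : ℕ → Bool
  isCPeak  i = (Sinv i <ᵇ i) ∧ (S i <ᵇ i)
  isCVal   i = (i <ᵇ Sinv i) ∧ (i <ᵇ S i)
  isCDRise i = (Sinv i <ᵇ i) ∧ (i <ᵇ S i)
  isCDFall i = (i <ᵇ Sinv i) ∧ (S i <ᵇ i)
  isFix    i = S i ≡ᵇ i

  isRec isARec isERec isEARec isNeither : ℕ → Bool
  isRec  i = allB (λ j → S j <ᵇ S i) (range (i ∸ 1))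
  isARec i = allB (λ j → if i <ᵇ j then S i <ᵇ S j else true) (range n)
  isERec  i = isRec i ∧ not (isARec i)
  isEARec i = isARec i ∧ not (isRec i)
  isNeither i = not (isRec i) ∧ not (isARec i)

  cnt : (ℕ → Bool) → ℕ
  cnt p = count p (range n)

  eareccpeak eareccdfall ereccval ereccdrise : ℕ
  eareccpeak  = cnt (λ i → isCPeak i ∧ isEARec i)
  eareccdfall = cnt (λ i → isCDFall i ∧ isEARec i)
  ereccval    = cnt (λ i → isCVal i ∧ isERec i)
  ereccdrise  = cnt (λ i → isCDRise i ∧ isERec i)

  nrcpeak nrcdfall nrcval nrcdrise : ℕ
  nrcpeak  = cnt (λ i → isCPeak i ∧ isNeither i)
  nrcdfall = cnt (λ i → isCDFall i ∧ isNeither i)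
  nrcval   = cnt (λ i → isCVal i ∧ isNeither i)
  nrcdrise = cnt (λ i → isCDRise i ∧ isNeither i)

  psnestAt : ℕ → ℕ
  psnestAt i = count (λ j → i <ᵇ S j) (range (i ∸ 1))

  fixList : List ℕ
  fixList = filterB isFix (range n)

  psnest : ℕ
  psnest = foldr (λ i a → psnestAt i Data.Nat.Base.+ a) 0 fixList

  -- ucross(j) = #{(i,k,l) : i<j<k<l, k=σ(i), l=σ(j)}
  ucross : ℕ → ℕ
  ucross j = count (λ i → (j <ᵇ S i) ∧ (S i <ᵇ S j)) (range (j ∸ 1))
  -- unest(j) = #{(i,k,l) : i<j<k<l, k=σ(j), l=σ(i)}
  unest : ℕ → ℕ
  unest j = count (λ i → (j <ᵇ S j) ∧ (S j <ᵇ S i)) (range (j ∸ 1))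
  -- lcross(k) = #{(i,j,l) : i<j<k<l, i=σ(k), j=σ(l)}
  lcross : ℕ → ℕ
  lcross k = count (λ l → (k <ᵇ l) ∧ (S k <ᵇ S l) ∧ (S l <ᵇ k)) (range n)
  -- lnest(k) = #{(i,j,l) : i<j<k<l, i=σ(l), j=σ(k)}
  lnest : ℕ → ℕ
  lnest k = count (λ l → (k <ᵇ l) ∧ (S l <ᵇ S k) ∧ (S k <ᵇ k)) (range n)

  sumOver : (ℕ → Bool) → (ℕ → ℕ) → ℕ
  sumOver p f = foldr (λ i a → (if p i then f i else 0) Data.Nat.Base.+ a) 0 (range n)

  ucrosscval ucrosscdrise unestcval unestcdrise : ℕ
  ucrosscval   = sumOver isCVal ucross
  ucrosscdrise = sumOver isCDRise ucross
  unestcval    = sumOver isCVal unest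
  unestcdrise  = sumOver isCDRise unest

  lcrosscpeak lcrosscdfall lnestcpeak lnestcdfall : ℕ
  lcrosscpeak  = sumOver isCPeak lcross
  lcrosscdfall = sumOver isCDFall lcross
  lnestcpeak   = sumOver isCPeak lnest
  lnestcdfall  = sumOver isCDFall lnest

  iter : ℕ → ℕ → ℕ
  iter zero i = i
  iter (suc k) i = S (iter k i)

  isCycMin : ℕ → Bool
  isCycMin i = allB (λ k → i ≤ᵇ iter k i) (upTo n)

  cyc : ℕ
  cyc = cnt isCycMin

-- Ring-valued part.  Commuting indeterminates are modelled by arbitrary
-- elements of an arbitrary commutative ring (polynomial identity over ℤ
-- ⇔ identity in every commutative ring under every assignment).

module RingDefs {c ℓ : Level} (R : CommutativeRing c ℓ) where
  open CommutativeRing R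

  pow : Carrier → ℕ → Carrier
  pow x zero = 1#
  pow x (suc m) = x * pow x m

  fromℕ : ℕ → Carrier
  fromℕ zero = 0#
  fromℕ (suc m) = 1# + fromℕ m

  sumL : List Carrier → Carrier
  sumL = foldr _+_ 0#

  prodL : List Carrier → Carrier
  prodL = foldr _*_ 1#

  qint : Carrier → Carrier → ℕ → Carrier
  qint p q m = sumL (map (λ j → pow p (m ∸ 1 ∸ j) * pow q j) (upTo m))

  record Vars : Set c where
    field
      x₁ x₂ y₁ y₂ u₁ u₂ v₁ v₂ : Carrier
      p₊₁ p₊₂ p₋₁ p₋₂ q₊₁ q₊₂ q₋₁ q₋₂ : Carrier
      s lam : Carrier
      w : ℕ → Carrier

  module _ (V : Vars) where
    open Vars V

    weight : List ℕ → Carrier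
    weight σ =
      pow x₁ (eareccpeak σ) * pow x₂ (eareccdfall σ) *
      pow y₁ (ereccval σ) * pow y₂ (ereccdrise σ) *
      pow u₁ (nrcpeak σ) * pow u₂ (nrcdfall σ) *
      pow v₁ (nrcval σ) * pow v₂ (nrcdrise σ) *
      prodL (map (λ i → w (psnestAt σ i)) (fixList σ)) *
      pow p₊₁ (ucrosscval σ) * pow p₊₂ (ucrosscdrise σ) *
      pow p₋₁ (lcrosscpeak σ) * pow p₋₂ (lcrosscdfall σ) *
      pow q₊₁ (unestcval σ) * pow q₊₂ (unestcdrise σ) *
      pow q₋₁ (lnestcpeak σ) * pow q₋₂ (lnestcdfall σ) *
      pow s (psnest σ) * pow lam (cyc σ)

    Qhat : ℕ → Carrier
    Qhat n = sumL (map weight (perms n))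

    γ : ℕ → Carrier
    γ zero = lam * w 0
    γ (suc m) = (pow p₋₂ m * x₂ + q₋₂ * qint p₋₂ q₋₂ m * u₂)
              + (pow p₊₂ m * y₂ + q₊₂ * qint p₊₂ q₊₂ m * v₂)
              + lam * pow s (suc m) * w (suc m)

    -- β_0 is never used
    β : ℕ → Carrier
    β zero = 0#
    β (suc m) = (lam + fromℕ m) * (pow p₋₁ m * x₁ + q₋₁ * qint p₋₁ q₋₁ m * u₁)
              * pow p₊₁ m * y₁

  -- Power series expansion of the J-fraction with coefficients γ, β.
  -- f_k = 1 / (1 - γ_k t - β_{k+1} t² f_{k+1}), i.e. f_k is the unique
  -- power series with f_k = 1 + γ_k t f_k + β_{k+1} t² f_{k+1} f_k.
  -- Jcoef γ β n k = [tⁿ] f_k; the J-fraction of the statement is f_0.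
  module _ (γ' β' : ℕ → Carrier) where
    -- compute [t^m] f_k from the table g of lower coefficients
    step : (ℕ → ℕ → Carrier) → ℕ → ℕ → Carrier
    step g zero k = 1#
    step g (suc zero) k = γ' k * g 0 k
    step g (suc (suc m)) k =
      γ' k * g (suc m) k
      + β' (suc k) * sumL (map (λ a → g a (suc k) * g (m ∸ a) k) (upTo (suc m)))

    -- tab n m k = [t^m] f_k for all m ≤ n
    tab : ℕ → ℕ → ℕ → Carrier
    tab zero m k = step (λ _ _ → 0#) 0 k
    tab (suc n) m k = if m ≤ᵇ n then tab n m k else step (tab n) (suc n) k

    Jcoef : ℕ → ℕ → Carrier
    Jcoef n k = tab n n k

{-# OPTIONS --safe #-}
module Submission where

-- Read a permutation σ from its last position to its first.  After the
-- positions i + 1, …, n only the relative order of the letters ≤ i used so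
-- far matters, so that the state is a word over {1, …, m + k} of length k
-- (its positions being numbered m + 1, …, m + k) that contains 1, …, m.
-- Every statistic is a sum over the positions i of a quantity that depends
-- on the tail of σ at i only.  Summing over the letter at the next position
-- thus gives a recursion over Motzkin paths, m being the height.
-- The factor λ + m at a cycle valley: when i is to be joined to one of m + 1
-- unused letters, exactly one of them, the start of the path that ends in i,
-- closes a cycle; for v₁ = y₁ and q₊₁ = p₊₁ the remaining weight does not
-- depend on the choice.

open import Defs
open import Level using (Level)
open import Algebra.Bundles using (CommutativeRing; CommutativeMonoid)
open import Data.Nat.Base using (ℕ; zero; suc; _∸_; _<ᵇ_; _≤ᵇ_; _≡ᵇ_; _≤_; _<_; z≤n; s≤s)
import Data.Nat.Base as ℕ
import Data.Nat.Properties as ℕₚ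
open import Data.Bool.Base using (Bool; true; false; _∧_; _∨_; not; if_then_else_; T)
import Data.Bool.Properties as 𝔹ₚ
open import Data.List.Base using (List; []; _∷_; length; map; foldr; upTo; applyUpTo; concatMap; _++_)
import Data.List.Properties as Lₚ
open import Data.List.Relation.Unary.All using (All; []; _∷_)
import Data.List.Relation.Unary.All as All
import Data.List.Relation.Unary.All.Properties as Allₚ
open import Data.Fin.Base using (toℕ; fromℕ<)
import Data.Fin.Properties as Finₚ
open import Data.Product.Base using (∃; _×_; _,_; proj₁; proj₂)
open import Data.Sum.Base using (inj₁; inj₂)
open import Data.Empty using (⊥; ⊥-elim)
open import Function.Base using (_∘_; id; const; case_of_)
open import Relation.Binary.Definitions using (tri<; tri≈; tri>)
open import Relation.Binary.PropositionalEquality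
  using (_≡_; _≢_; refl; sym; trans; cong; cong₂; subst; subst₂; module ≡-Reasoning)

≡true⇒T : ∀ {b} → b ≡ true → T b
≡true⇒T refl = _

T⇒≡true : ∀ {b} → T b → b ≡ true
T⇒≡true {true} _ = refl

<⇒<ᵇ≡true : ∀ {a b} → a < b → (a <ᵇ b) ≡ true
<⇒<ᵇ≡true p = T⇒≡true (ℕₚ.<⇒<ᵇ p)

<ᵇ≡true⇒< : ∀ a b → (a <ᵇ b) ≡ true → a < b
<ᵇ≡true⇒< a b e = ℕₚ.<ᵇ⇒< a b (≡true⇒T e)

≥⇒<ᵇ≡false : ∀ {a b} → b ≤ a → (a <ᵇ b) ≡ false
≥⇒<ᵇ≡false {a} {b} p with a <ᵇ b in e
... | true  = ⊥-elim (ℕₚ.<⇒≱ (<ᵇ≡true⇒< a b e) p)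
... | false = refl

<ᵇ-irrefl : ∀ n → (n <ᵇ n) ≡ false
<ᵇ-irrefl n = ≥⇒<ᵇ≡false (ℕₚ.≤-refl {n})

≡ᵇ-refl : ∀ a → (a ≡ᵇ a) ≡ true
≡ᵇ-refl zero = refl
≡ᵇ-refl (suc a) = ≡ᵇ-refl a

≡ᵇ-sym : ∀ a b → (a ≡ᵇ b) ≡ (b ≡ᵇ a)
≡ᵇ-sym zero zero = refl
≡ᵇ-sym zero (suc b) = refl
≡ᵇ-sym (suc a) zero = refl
≡ᵇ-sym (suc a) (suc b) = ≡ᵇ-sym a b

≡ᵇ≡true⇒≡ : ∀ a b → (a ≡ᵇ b) ≡ true → a ≡ b
≡ᵇ≡true⇒≡ a b e = ℕₚ.≡ᵇ⇒≡ a b (≡true⇒T e)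

≢⇒≡ᵇ≡false : ∀ {a b} → a ≢ b → (a ≡ᵇ b) ≡ false
≢⇒≡ᵇ≡false {a} {b} p with a ≡ᵇ b in e
... | true  = ⊥-elim (p (≡ᵇ≡true⇒≡ a b e))
... | false = refl

≡ᵇ≡false⇒≢ : ∀ a b → (a ≡ᵇ b) ≡ false → a ≢ b
≡ᵇ≡false⇒≢ a .a e refl = case trans (sym e) (≡ᵇ-refl a) of λ ()

true≢false : ∀ {b} → b ≡ true → b ≡ false → ⊥
true≢false refl ()

∧-true⁻ˡ : ∀ {a b} → a ∧ b ≡ true → a ≡ true
∧-true⁻ˡ {true} _ = refl

∧-true⁻ʳ : ∀ {a b} → a ∧ b ≡ true → b ≡ true
∧-true⁻ʳ {true} e = e

not-true⁻ : ∀ {a} → not a ≡ true → a ≡ false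
not-true⁻ {false} _ = refl

-- skip r enumerates ℕ without r in increasing order.
skip : ℕ → ℕ → ℕ
skip zero    v       = suc v
skip (suc r) zero    = zero
skip (suc r) (suc v) = suc (skip r v)

skip-< : ∀ {r v} → v < r → skip r v ≡ v
skip-< {suc r} {zero} p = refl
skip-< {suc r} {suc v} (s≤s p) = cong suc (skip-< p)

skip-≥ : ∀ {r v} → r ≤ v → skip r v ≡ suc v
skip-≥ {zero} p = refl
skip-≥ {suc r} {suc v} (s≤s p) = cong suc (skip-≥ p)

skip-<ᵇ : ∀ r a b → (skip r a <ᵇ skip r b) ≡ (a <ᵇ b)
skip-<ᵇ zero a b = refl
skip-<ᵇ (suc r) zero zero = refl
skip-<ᵇ (suc r) zero (suc b) = refl
skip-<ᵇ (suc r) (suc a) zero = refl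
skip-<ᵇ (suc r) (suc a) (suc b) = skip-<ᵇ r a b

skip-≡ᵇ : ∀ r a b → (skip r a ≡ᵇ skip r b) ≡ (a ≡ᵇ b)
skip-≡ᵇ zero a b = refl
skip-≡ᵇ (suc r) zero zero = refl
skip-≡ᵇ (suc r) zero (suc b) = refl
skip-≡ᵇ (suc r) (suc a) zero = refl
skip-≡ᵇ (suc r) (suc a) (suc b) = skip-≡ᵇ r a b

skip-avoids : ∀ r v → (r ≡ᵇ skip r v) ≡ false
skip-avoids zero v = refl
skip-avoids (suc r) zero = refl
skip-avoids (suc r) (suc v) = skip-avoids r v

skip-bound : ∀ r v n → v < n → skip r v < suc n
skip-bound zero v n p = s≤s p
skip-bound (suc r) zero n p = s≤s z≤n
skip-bound (suc r) (suc v) (suc n) (s≤s p) = s≤s (skip-bound r v n p)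

-- Iterated operations in a commutative monoid.

module BigOp {c ℓ} (M : CommutativeMonoid c ℓ) where
  open CommutativeMonoid M renaming (refl to ≈-refl; sym to ≈-sym; trans to ≈-trans)

  open import Algebra.Properties.CommutativeSemigroup commutativeSemigroup
    using (interchange; x∙yz≈y∙xz)

  ⨁ : ℕ → (ℕ → Carrier) → Carrier
  ⨁ zero    g = ε
  ⨁ (suc n) g = g 0 ∙ ⨁ n (g ∘ suc)

  ⨁-cong : ∀ n {g h} → (∀ v → v < n → g v ≈ h v) → ⨁ n g ≈ ⨁ n h
  ⨁-cong zero e = ≈-refl
  ⨁-cong (suc n) e = ∙-cong (e 0 (s≤s z≤n)) (⨁-cong n λ v p → e (suc v) (s≤s p))

  ⨁-ε : ∀ n → ⨁ n (const ε) ≈ ε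
  ⨁-ε zero = ≈-refl
  ⨁-ε (suc n) = ≈-trans (identityˡ _) (⨁-ε n)

  ⨁-∙ : ∀ n g h → ⨁ n (λ v → g v ∙ h v) ≈ ⨁ n g ∙ ⨁ n h
  ⨁-∙ zero g h = ≈-sym (identityˡ ε)
  ⨁-∙ (suc n) g h = ≈-trans (∙-congˡ (⨁-∙ n _ _)) (interchange _ _ _ _)

  ⨁-skip : ∀ {n r} g → r ≤ n → ⨁ (suc n) g ≈ g r ∙ ⨁ n (g ∘ skip r)
  ⨁-skip {r = zero} g p = ≈-refl
  ⨁-skip {suc n} {suc r} g (s≤s p) =
    ≈-trans (∙-congˡ (⨁-skip (g ∘ suc) p)) (x∙yz≈y∙xz _ _ _)

  ⨁-++ : ∀ m n g → ⨁ (m ℕ.+ n) g ≈ ⨁ m g ∙ ⨁ n (g ∘ (m ℕ.+_))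
  ⨁-++ zero n g = ≈-sym (identityˡ _)
  ⨁-++ (suc m) n g = ≈-trans (∙-congˡ (⨁-++ m n (g ∘ suc))) (≈-sym (assoc _ _ _))

  ⨁-last : ∀ n g → ⨁ (suc n) g ≈ ⨁ n g ∙ g n
  ⨁-last zero g = comm _ _
  ⨁-last (suc n) g = ≈-trans (∙-congˡ (⨁-last n (g ∘ suc))) (≈-sym (assoc _ _ _))

  ⨁-comm : ∀ m n (g : ℕ → ℕ → Carrier) →
            ⨁ m (λ i → ⨁ n (g i)) ≈ ⨁ n (λ j → ⨁ m (λ i → g i j))
  ⨁-comm zero n g = ≈-sym (⨁-ε n)
  ⨁-comm (suc m) n g = ≈-trans (∙-congˡ (⨁-comm m n (g ∘ suc))) (≈-sym (⨁-∙ n _ _))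

  foldr-upTo : ∀ n (f : ℕ → ℕ) (g : ℕ → Carrier) →
               foldr (λ x a → g x ∙ a) ε (applyUpTo f n) ≡ ⨁ n (g ∘ f)
  foldr-upTo zero f g = refl
  foldr-upTo (suc n) f g = cong (g (f 0) ∙_) (foldr-upTo n (f ∘ suc) g)

  foldr-range : ∀ n (g : ℕ → Carrier) →
                foldr (λ x a → g x ∙ a) ε (range n) ≡ ⨁ n (g ∘ suc)
  foldr-range n g = trans (cong (foldr (λ x a → g x ∙ a) ε) (Lₚ.map-applyUpTo id suc n))
                          (foldr-upTo n suc g)

open BigOp ℕₚ.+-0-commutativeMonoid public using () renaming
  ( ⨁ to Σℕ; ⨁-cong to Σℕ-cong; ⨁-ε to Σℕ-0; ⨁-∙ to Σℕ-+; ⨁-skip to Σℕ-skip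
  ; ⨁-++ to Σℕ-++; ⨁-last to Σℕ-last; foldr-range to Σℕ-range)
open BigOp 𝔹ₚ.∧-commutativeMonoid public using () renaming
  ( ⨁ to ⋀; ⨁-cong to ⋀-cong; ⨁-skip to ⋀-skip; ⨁-++ to ⋀-++; ⨁-last to ⋀-last; foldr-range to ⋀-range)

bit : Bool → ℕ
bit b = if b then 1 else 0

countTo : ℕ → (ℕ → Bool) → ℕ
countTo N p = Σℕ N (bit ∘ p ∘ suc)

count≡foldr : ∀ p xs → count p xs ≡ foldr (λ x a → bit (p x) ℕ.+ a) 0 xs
count≡foldr p [] = refl
count≡foldr p (x ∷ xs) with p x
... | true  = cong suc (count≡foldr p xs)
... | false = count≡foldr p xs

count-range : ∀ p n → count p (range n) ≡ countTo n p
count-range p n = trans (count≡foldr p (range n)) (Σℕ-range n (bit ∘ p))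

⋀-true⁻ : ∀ {n p} → ⋀ n p ≡ true → ∀ {v} → v < n → p v ≡ true
⋀-true⁻ {suc n} {p} e {zero} q = ∧-true⁻ˡ {p 0} e
⋀-true⁻ {suc n} {p} e {suc v} (s≤s q) = ⋀-true⁻ (∧-true⁻ʳ {p 0} e) q

⋀-true⁺ : ∀ n {p} → (∀ v → v < n → p v ≡ true) → ⋀ n p ≡ true
⋀-true⁺ zero e = refl
⋀-true⁺ (suc n) e = cong₂ _∧_ (e 0 (s≤s z≤n)) (⋀-true⁺ n λ v q → e (suc v) (s≤s q))

-- Membership, distinctness and required letters under relabelling.

mem : ℕ → List ℕ → Bool
mem v = anyB (λ y → v ≡ᵇ y)

mem-skip : ∀ r v xs → mem (skip r v) (map (skip r) xs) ≡ mem v xs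
mem-skip r v [] = refl
mem-skip r v (x ∷ xs) = cong₂ _∨_ (skip-≡ᵇ r v x) (mem-skip r v xs)

mem-avoid : ∀ r xs → mem r (map (skip r) xs) ≡ false
mem-avoid r [] = refl
mem-avoid r (x ∷ xs) = cong₂ _∨_ (skip-avoids r x) (mem-avoid r xs)

distinct-skip : ∀ r xs → distinctB (map (skip r) xs) ≡ distinctB xs
distinct-skip r [] = refl
distinct-skip r (x ∷ xs) = cong₂ (λ a b → not a ∧ b) (mem-skip r x xs) (distinct-skip r xs)

full : ℕ → List ℕ → Bool
full m xs = ⋀ m (λ v → mem (suc v) xs)

-- The head meets the requirement `suc a`, and the other required letters are the images of 1, ...,
-- m under `skip (suc a)`. Deleting a required letter thus lowers the height by one.
full-∷-small : ∀ m a xs → a ≤ m →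
  full (suc m) (suc a ∷ map (skip (suc a)) xs) ≡ full m xs
full-∷-small m a xs a≤m = begin
  full (suc m) ys                            ≡⟨ ⋀-skip (λ v → mem (suc v) ys) a≤m ⟩
  mem (suc a) ys ∧ ⋀ m (mem′ ∘ skip a)       ≡⟨ cong (λ b → (b ∨ mem (suc a) xs′) ∧ ⋀ m (mem′ ∘ skip a)) (≡ᵇ-refl a) ⟩
  ⋀ m (mem′ ∘ skip a)                        ≡⟨ ⋀-cong m (λ v _ → cong₂ _∨_ (trans (≡ᵇ-sym (skip a v) a) (skip-avoids a v)) (mem-skip (suc a) (suc v) xs)) ⟩
  full m xs                                  ∎
  where
  open ≡-Reasoning
  xs′ = map (skip (suc a)) xs
  ys = suc a ∷ xs′
  mem′ = λ v → mem (suc v) ys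

full-∷-large : ∀ m a xs → m ≤ a → full m (suc a ∷ xs) ≡ full m xs
full-∷-large m a xs m≤a = ⋀-cong m λ v v<m →
  cong (_∨ mem (suc v) xs) (≢⇒≡ᵇ≡false {v} {a} λ { refl → ℕₚ.<⇒≱ v<m m≤a })

full-skip-large : ∀ m a xs → m ≤ a → full m (map (skip (suc a)) xs) ≡ full m xs
full-skip-large m a xs m≤a = ⋀-cong m λ v v<m → trans
  (cong (λ u → mem (suc u) (map (skip (suc a)) xs)) (sym (skip-< {a} {v} (ℕₚ.<-≤-trans v<m m≤a))))
  (mem-skip (suc a) (suc v) xs)

InRange : ℕ → List ℕ → Set
InRange N = All (λ v → 1 ≤ v × v ≤ N)

good : ℕ → List ℕ → Bool
good m xs = distinctB xs ∧ full m xs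

-- In a permutation with the letter x at position i and the tail xs after it,
-- the letters before position i are those not in x ∷ xs, so that the crossings
-- and nestings at i are determined by x and xs.
lcrossing lnesting ucrossing unesting : ℕ → ℕ → List ℕ → ℕ → Bool
lcrossing i x xs v = mem v xs ∧ (x <ᵇ v) ∧ (v <ᵇ i)
lnesting  i x xs v = mem v xs ∧ (v <ᵇ x)
ucrossing i x xs v = not (mem v xs) ∧ (i <ᵇ v) ∧ (v <ᵇ x)
unesting  i x xs v = not (mem v xs) ∧ (i <ᵇ v) ∧ (x <ᵇ v)

-- Serves twice: at a fixed point these letters are the pseudo-nestings of `i`, and for any tail
-- they are the letters still available to an arc from `i` to a larger letter.
gap : ℕ → List ℕ → ℕ → Bool
gap i xs v = not (mem v xs) ∧ (i <ᵇ v)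

lcrossTail lnestTail ucrossTail unestTail : ℕ → ℕ → List ℕ → ℕ
lcrossTail i x xs = countTo (i ℕ.+ length xs) (lcrossing i x xs)
lnestTail  i x xs = countTo (i ℕ.+ length xs) (lnesting i x xs)
ucrossTail i x xs = countTo (i ℕ.+ length xs) (ucrossing i x xs)
unestTail  i x xs = countTo (i ℕ.+ length xs) (unesting i x xs)

gaps : ℕ → List ℕ → ℕ
gaps i xs = countTo (i ℕ.+ length xs) (gap i xs)

-- Draw the arcs from the positions i, i+1, … to the letters of xs;
-- pathStart i xs v is the beginning of the path that ends in v.
pathStart : ℕ → List ℕ → ℕ → ℕ
pathStart i []       v = v
pathStart i (x ∷ xs) v =
  if pathStart (suc i) xs v ≡ᵇ x then pathStart (suc i) xs i else pathStart (suc i) xs v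

-- Invariance of the tail statistics under deletion of a letter.

∧-falseˡ : ∀ {a b} → a ≡ false → a ∧ b ≡ false
∧-falseˡ refl = refl

∧-falseʳ : ∀ {a b} → b ≡ false → a ∧ b ≡ false
∧-falseʳ refl = 𝔹ₚ.∧-zeroʳ _

countTo-skip : ∀ {N r} (P P′ : ℕ → Bool) → r ≤ N → P′ (suc r) ≡ false →
         (∀ v → P′ (skip (suc r) v) ≡ P v) → countTo (suc N) P′ ≡ countTo N P
countTo-skip {N} {r} P P′ r≤N e h = trans (Σℕ-skip (bit ∘ P′ ∘ suc) r≤N)
  (cong₂ ℕ._+_ (cong bit e) (Σℕ-cong N λ v _ → cong bit (h (suc v))))

skip-<ᵇˡ : ∀ {r i} v → r ≤ i → (suc i <ᵇ skip r v) ≡ (i <ᵇ v)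
skip-<ᵇˡ {r} {i} v p = trans (cong (_<ᵇ skip r v) (sym (skip-≥ p))) (skip-<ᵇ r i v)

skip-<ᵇʳ : ∀ {r i} v → r ≤ i → (skip r v <ᵇ suc i) ≡ (v <ᵇ i)
skip-<ᵇʳ {r} {i} v p = trans (cong (skip r v <ᵇ_) (sym (skip-≥ p))) (skip-<ᵇ r v i)

skip-mem-pos : ∀ {r i} xs → r ≤ i → mem (suc i) (map (skip r) xs) ≡ mem i xs
skip-mem-pos {r} {i} xs p =
  trans (cong (λ j → mem j (map (skip r) xs)) (sym (skip-≥ p))) (mem-skip r i xs)

module _ {i r : ℕ} (r<i : r < i) (x : ℕ) (xs : List ℕ) where
  private
    φ = skip (suc r)
    r≤N : r ≤ i ℕ.+ length xs
    r≤N = ℕₚ.≤-trans (ℕₚ.<⇒≤ r<i) (ℕₚ.m≤m+n i _)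
    i≮r : (suc i <ᵇ suc r) ≡ false
    i≮r = ≥⇒<ᵇ≡false (s≤s (ℕₚ.<⇒≤ r<i))

  lcrossTail-skip : lcrossTail (suc i) (φ x) (map φ xs) ≡ lcrossTail i x xs
  lcrossTail-skip rewrite Lₚ.length-map φ xs = countTo-skip (lcrossing i x xs) (lcrossing (suc i) (φ x) (map φ xs)) r≤N
    (∧-falseˡ (mem-avoid (suc r) xs))
    λ v → cong₂ _∧_ (mem-skip (suc r) v xs) (cong₂ _∧_ (skip-<ᵇ (suc r) x v) (skip-<ᵇʳ v r<i))

  lnestTail-skip : lnestTail (suc i) (φ x) (map φ xs) ≡ lnestTail i x xs
  lnestTail-skip rewrite Lₚ.length-map φ xs = countTo-skip (lnesting i x xs) (lnesting (suc i) (φ x) (map φ xs)) r≤N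
    (∧-falseˡ (mem-avoid (suc r) xs))
    λ v → cong₂ _∧_ (mem-skip (suc r) v xs) (skip-<ᵇ (suc r) v x)

  ucrossTail-skip : ucrossTail (suc i) (φ x) (map φ xs) ≡ ucrossTail i x xs
  ucrossTail-skip rewrite Lₚ.length-map φ xs = countTo-skip (ucrossing i x xs) (ucrossing (suc i) (φ x) (map φ xs)) r≤N
    (∧-falseʳ {not (mem (suc r) (map φ xs))} (∧-falseˡ i≮r))
    λ v → cong₂ _∧_ (cong not (mem-skip (suc r) v xs)) (cong₂ _∧_ (skip-<ᵇˡ v r<i) (skip-<ᵇ (suc r) v x))

  unestTail-skip : unestTail (suc i) (φ x) (map φ xs) ≡ unestTail i x xs
  unestTail-skip rewrite Lₚ.length-map φ xs = countTo-skip (unesting i x xs) (unesting (suc i) (φ x) (map φ xs)) r≤N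
    (∧-falseʳ {not (mem (suc r) (map φ xs))} (∧-falseˡ i≮r))
    λ v → cong₂ _∧_ (cong not (mem-skip (suc r) v xs)) (cong₂ _∧_ (skip-<ᵇˡ v r<i) (skip-<ᵇ (suc r) x v))

  gaps-skip : gaps (suc i) (map φ xs) ≡ gaps i xs
  gaps-skip rewrite Lₚ.length-map φ xs = countTo-skip (gap i xs) (gap (suc i) (map φ xs)) r≤N
    (∧-falseʳ {not (mem (suc r) (map φ xs))} i≮r)
    λ v → cong₂ _∧_ (cong not (mem-skip (suc r) v xs)) (skip-<ᵇˡ v r<i)

-- Letters and positions are vertices of one graph. Since `r ≤ i`, every position from `i` on is
-- moved up by one under `skip r`, so that the relabelling carries arcs to arcs.
pathStart-skip : ∀ {r i} xs v → r ≤ i →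
  pathStart (suc i) (map (skip r) xs) (skip r v) ≡ skip r (pathStart i xs v)
pathStart-skip [] v p = refl
pathStart-skip {r} {i} (x ∷ xs) v p
  rewrite pathStart-skip {r} {suc i} xs v (ℕₚ.m≤n⇒m≤1+n p)
        | skip-≡ᵇ r (pathStart (suc i) xs v) x
  with pathStart (suc i) xs v ≡ᵇ x
... | false = refl
... | true  = trans (cong (pathStart (suc (suc i)) (map (skip r) xs)) (sym (skip-≥ p)))
                    (pathStart-skip {r} {suc i} xs i (ℕₚ.m≤n⇒m≤1+n p))

-- By induction the vertices up to `i` have distinct starts before the arc from `i` to `x` is added.
-- At most one vertex below `i` then has the start `x`; it takes over the start of `i`, which no
-- vertex below `i` had.
pathStart-injective : ∀ i xs {u v} → u < i → v < i → pathStart i xs u ≡ pathStart i xs v → u ≡ v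
pathStart-injective i [] u<i v<i e = e
pathStart-injective i (x ∷ xs) {u} {v} u<i v<i e
  with pathStart (suc i) xs u ≡ᵇ x in eu | pathStart (suc i) xs v ≡ᵇ x in ev
... | false | false = pathStart-injective (suc i) xs (ℕₚ.m<n⇒m<1+n u<i) (ℕₚ.m<n⇒m<1+n v<i) e
... | true  | true  = pathStart-injective (suc i) xs (ℕₚ.m<n⇒m<1+n u<i) (ℕₚ.m<n⇒m<1+n v<i)
                        (trans (≡ᵇ≡true⇒≡ _ x eu) (sym (≡ᵇ≡true⇒≡ _ x ev)))
... | true  | false = ⊥-elim (ℕₚ.<-irrefl (sym (pathStart-injective (suc i) xs ℕₚ.≤-refl (ℕₚ.m<n⇒m<1+n v<i) e)) v<i)
... | false | true  = ⊥-elim (ℕₚ.<-irrefl (pathStart-injective (suc i) xs (ℕₚ.m<n⇒m<1+n u<i) ℕₚ.≤-refl e) u<i)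

-- If the start was `x` before the arc from `i` was added, it becomes the start of `i`, which is not
-- in `xs` by induction and differs from `x` by injectivity.
pathStart-unused : ∀ i xs {v} → v < i → mem (pathStart i xs v) xs ≡ false
pathStart-unused i [] v<i = refl
pathStart-unused i (x ∷ xs) {v} v<i with pathStart (suc i) xs v ≡ᵇ x in e
... | false = cong₂ _∨_ e (pathStart-unused (suc i) xs (ℕₚ.m<n⇒m<1+n v<i))
... | true  = cong₂ _∨_
  (≢⇒≡ᵇ≡false λ e′ → ℕₚ.<-irrefl (pathStart-injective (suc i) xs (ℕₚ.m<n⇒m<1+n v<i) ℕₚ.≤-refl
      (trans (≡ᵇ≡true⇒≡ _ x e) (sym e′))) v<i)
  (pathStart-unused (suc i) xs ℕₚ.≤-refl)

pathStart-of-unused : ∀ i xs {v} → mem v xs ≡ false → pathStart i xs v ≡ v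
pathStart-of-unused i [] e = refl
pathStart-of-unused i (x ∷ xs) {v} e with v ≡ᵇ x in v≢x
... | false rewrite pathStart-of-unused (suc i) xs {v} e | v≢x = refl

-- A used letter is the end of an arc, so its path is not trivial and begins at a position, that is,
-- at `i` or later.
pathStart-of-used : ∀ i xs {v} → distinctB xs ≡ true → mem v xs ≡ true → i ≤ pathStart i xs v
pathStart-of-used i (x ∷ xs) {v} d e with v ≡ᵇ x in v≡x
... | false with pathStart (suc i) xs v ≡ᵇ x
...   | false = ℕₚ.<⇒≤ (pathStart-of-used (suc i) xs (∧-true⁻ʳ d) e)
...   | true with mem i xs in ei
...     | true  = ℕₚ.<⇒≤ (pathStart-of-used (suc i) xs (∧-true⁻ʳ d) ei)
...     | false = ℕₚ.≤-reflexive (sym (pathStart-of-unused (suc i) xs ei))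
-- Here `v = x` does not recur in `xs`, so it is its own start until the arc from `i` reaches it.
pathStart-of-used i (x ∷ xs) {v} d e | true
  rewrite ≡ᵇ≡true⇒≡ v x v≡x | pathStart-of-unused (suc i) xs {x} (not-true⁻ (∧-true⁻ˡ d)) | ≡ᵇ-refl x
  with mem i xs in ei
... | true  = ℕₚ.<⇒≤ (pathStart-of-used (suc i) xs (∧-true⁻ʳ d) ei)
... | false = ℕₚ.≤-reflexive (sym (pathStart-of-unused (suc i) xs ei))

pathStart-≤ : ∀ i xs {v} → v < i ℕ.+ length xs → pathStart i xs v < i ℕ.+ length xs
pathStart-≤ i [] p = p
pathStart-≤ i (x ∷ xs) {v} p rewrite ℕₚ.+-suc i (length xs) with pathStart (suc i) xs v ≡ᵇ x
... | false = pathStart-≤ (suc i) xs p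
... | true  = pathStart-≤ (suc i) xs (s≤s (ℕₚ.m≤m+n i _))

Σℕ-≡ᵇ : ∀ {N u} → u < N → (b : Bool) → Σℕ N (λ v → bit ((v ≡ᵇ u) ∧ b)) ≡ bit b
Σℕ-≡ᵇ {suc N} {zero} p b = trans (cong (bit b ℕ.+_) (Σℕ-0 N)) (ℕₚ.+-identityʳ _)
Σℕ-≡ᵇ {suc N} {suc u} (s≤s p) b = Σℕ-≡ᵇ p b

Σℕ-below : ∀ {N a} → a ≤ N → Σℕ N (λ v → bit (v <ᵇ a)) ≡ a
Σℕ-below {N} {zero} p = Σℕ-0 N
Σℕ-below {suc N} {suc a} (s≤s p) = cong suc (Σℕ-below p)

Σℕ-between : ∀ {N} a {m} → m ≤ N → Σℕ N (λ v → bit ((a <ᵇ v) ∧ (v <ᵇ m))) ≡ m ∸ suc a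
Σℕ-between {N} a {zero} p =
  trans (Σℕ-cong N λ v _ → cong bit (𝔹ₚ.∧-zeroʳ (a <ᵇ v))) (Σℕ-0 N)
Σℕ-between {suc N} zero {suc m} (s≤s p) = Σℕ-below p
Σℕ-between {suc N} (suc a) {suc m} (s≤s p) = Σℕ-between a p

Σℕ-true : ∀ N → Σℕ N (λ _ → 1) ≡ N
Σℕ-true zero = refl
Σℕ-true (suc N) = cong suc (Σℕ-true N)

countTo-used : ∀ {N} xs (P : ℕ → Bool) → distinctB xs ≡ true → InRange N xs →
         countTo N (λ v → mem v xs ∧ P v) ≡ count P xs
countTo-used {N} [] P d r = Σℕ-0 N
countTo-used {N} (suc x ∷ xs) P d ((_ , x<N) ∷ r) = begin
  countTo N (λ v → mem v (suc x ∷ xs) ∧ P v)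
    ≡⟨ Σℕ-cong N (λ v _ → split v) ⟩
  Σℕ N (λ v → bit ((v ≡ᵇ x) ∧ P (suc x)) ℕ.+ bit (mem (suc v) xs ∧ P (suc v)))
    ≡⟨ Σℕ-+ N _ _ ⟩
  Σℕ N (λ v → bit ((v ≡ᵇ x) ∧ P (suc x))) ℕ.+ countTo N (λ v → mem v xs ∧ P v)
    ≡⟨ cong₂ ℕ._+_ (Σℕ-≡ᵇ x<N (P (suc x))) (countTo-used xs P (∧-true⁻ʳ d) r) ⟩
  bit (P (suc x)) ℕ.+ count P xs
    ≡⟨ count-∷ ⟩
  count P (suc x ∷ xs) ∎
  where
  open ≡-Reasoning
  split : ∀ v → bit (((v ≡ᵇ x) ∨ mem (suc v) xs) ∧ P (suc v))
              ≡ bit ((v ≡ᵇ x) ∧ P (suc x)) ℕ.+ bit (mem (suc v) xs ∧ P (suc v))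
  split v with v ≡ᵇ x in e
  ... | false = refl
  ... | true rewrite ≡ᵇ≡true⇒≡ v x e | not-true⁻ {mem (suc x) xs} (∧-true⁻ˡ d) = sym (ℕₚ.+-identityʳ _)
  count-∷ : bit (P (suc x)) ℕ.+ count P xs ≡ count P (suc x ∷ xs)
  count-∷ with P (suc x)
  ... | true  = refl
  ... | false = refl

count-true : ∀ xs → count (const true) xs ≡ length xs
count-true [] = refl
count-true (x ∷ xs) = cong suc (count-true xs)

used-total : ∀ {N} xs → distinctB xs ≡ true → InRange N xs → countTo N (λ v → mem v xs) ≡ length xs
used-total {N} xs d r = trans (Σℕ-cong N λ v _ → cong bit (sym (𝔹ₚ.∧-identityʳ (mem (suc v) xs))))
  (trans (countTo-used xs (const true) d r) (count-true xs))

<ᵇ-+ : ∀ i a b → (i ℕ.+ a <ᵇ i ℕ.+ b) ≡ (a <ᵇ b)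
<ᵇ-+ zero a b = refl
<ᵇ-+ (suc i) a b = <ᵇ-+ i a b

<ᵇ-suc-+ : ∀ i t → (i <ᵇ suc (i ℕ.+ t)) ≡ true
<ᵇ-suc-+ i t = <⇒<ᵇ≡true (s≤s (ℕₚ.m≤m+n i t))

free : ℕ → List ℕ → ℕ → Bool
free i xs t = not (mem (suc (i ℕ.+ t)) xs)

module _ (i : ℕ) (xs : List ℕ) where
  private
    k = length xs
    U = free i xs

  countTo-above : ∀ (P : ℕ → Bool) → countTo (i ℕ.+ k) (λ v → not (mem v xs) ∧ (i <ᵇ v) ∧ P v)
                ≡ Σℕ k (λ t → bit (U t ∧ P (suc (i ℕ.+ t))))
  countTo-above P = trans (Σℕ-++ i k _) (cong₂ ℕ._+_
    (trans (Σℕ-cong i λ v v<i → cong bit (∧-falseʳ {not (mem (suc v) xs)} (∧-falseˡ (≥⇒<ᵇ≡false v<i)))) (Σℕ-0 i))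
    (Σℕ-cong k λ t _ → cong (λ b → bit (U t ∧ b ∧ P (suc (i ℕ.+ t)))) (<ᵇ-suc-+ i t)))

  ucrossTail-free : ∀ t → ucrossTail i (suc (i ℕ.+ t)) xs ≡ Σℕ k (λ s → bit (U s ∧ (s <ᵇ t)))
  ucrossTail-free t = trans (countTo-above (_<ᵇ suc (i ℕ.+ t)))
    (Σℕ-cong k λ s _ → cong (λ b → bit (U s ∧ b)) (<ᵇ-+ i s t))

  unestTail-free : ∀ t → unestTail i (suc (i ℕ.+ t)) xs ≡ Σℕ k (λ s → bit (U s ∧ (t <ᵇ s)))
  unestTail-free t = trans (countTo-above (suc (i ℕ.+ t) <ᵇ_))
    (Σℕ-cong k λ s _ → cong (λ b → bit (U s ∧ b)) (<ᵇ-+ i t s))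

  gaps-free : gaps i xs ≡ Σℕ k (bit ∘ U)
  gaps-free = trans (Σℕ-cong (i ℕ.+ k) λ v _ → cong (λ b → bit (not (mem (suc v) xs) ∧ b)) (sym (𝔹ₚ.∧-identityʳ (i <ᵇ suc v))))
    (trans (countTo-above (const true)) (Σℕ-cong k λ t _ → cong bit (𝔹ₚ.∧-identityʳ (U t))))

  -- k letters are used and k letters exceed i, so that the unused letters
  -- above i are as many as the used letters up to i.
  gaps≡used : distinctB xs ≡ true → InRange (i ℕ.+ k) xs → gaps i xs ≡ countTo i (λ v → mem v xs)
  gaps≡used d r = ℕₚ.+-cancelʳ-≡ usedAbove _ _ (begin
    gaps i xs ℕ.+ usedAbove                  ≡⟨ cong (ℕ._+ usedAbove) gaps-free ⟩
    Σℕ k (bit ∘ U) ℕ.+ usedAbove             ≡⟨ sym (Σℕ-+ k _ _) ⟩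
    Σℕ k (λ t → bit (U t) ℕ.+ bit (used t))  ≡⟨ Σℕ-cong k (λ t _ → complement (used t)) ⟩
    Σℕ k (λ _ → 1)                           ≡⟨ Σℕ-true k ⟩
    k                                        ≡⟨ sym (used-total xs d r) ⟩
    countTo (i ℕ.+ k) (λ v → mem v xs)             ≡⟨ Σℕ-++ i k _ ⟩
    countTo i (λ v → mem v xs) ℕ.+ usedAbove       ∎)
    where
    open ≡-Reasoning
    used = λ t → mem (suc (i ℕ.+ t)) xs
    usedAbove = Σℕ k (bit ∘ used)
    complement : ∀ b → bit (not b) ℕ.+ bit b ≡ 1
    complement true = refl
    complement false = refl

countTo-full : ∀ m xs → full m xs ≡ true → countTo m (λ v → mem v xs) ≡ m
countTo-full m xs e = trans (Σℕ-cong m λ v v<m → cong bit (⋀-true⁻ e v<m)) (Σℕ-true m)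

-- The used letters up to `suc m` are 1, ..., m and possibly `suc m` itself. Hence there are m
-- choices at a double rise and m + 1 at a valley.
gaps-good : ∀ m xs → distinctB xs ≡ true → InRange (suc m ℕ.+ length xs) xs → full m xs ≡ true →
            gaps (suc m) xs ≡ m ℕ.+ bit (mem (suc m) xs)
gaps-good m xs d r e = trans (gaps≡used (suc m) xs d r)
  (trans (Σℕ-last m (λ v → bit (mem (suc v) xs))) (cong (ℕ._+ bit (mem (suc m) xs)) (countTo-full m xs e)))

-- All letters up to m other than `suc a` must lie in `xs`. So crossings and nestings of an arc to a
-- smaller letter depend only on the height and the letter chosen.
module _ {m a : ℕ} (xs : List ℕ) (a<m : a < m) (e : full m (suc a ∷ xs) ≡ true) where
  private
    N = suc m ℕ.+ length xs
    used : ∀ {v} → v < m → (v ≡ᵇ a) ≡ false → mem (suc v) xs ≡ true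
    used {v} v<m v≢a = trans (sym (cong (_∨ mem (suc v) xs) v≢a)) (⋀-true⁻ e v<m)

  lcrossTail-good : lcrossTail (suc m) (suc a) xs ≡ m ∸ suc a
  lcrossTail-good = trans (Σℕ-cong N λ v _ → cong bit (drop v))
                          (Σℕ-between a (ℕₚ.≤-trans (ℕₚ.n≤1+n m) (ℕₚ.m≤m+n (suc m) _)))
    where
    drop : ∀ v → mem (suc v) xs ∧ (a <ᵇ v) ∧ (v <ᵇ m) ≡ (a <ᵇ v) ∧ (v <ᵇ m)
    drop v with a <ᵇ v in p | v <ᵇ m in q
    ... | false | _     = 𝔹ₚ.∧-zeroʳ _
    ... | true  | false = 𝔹ₚ.∧-zeroʳ _
    ... | true  | true  = cong (_∧ true)
      (used (<ᵇ≡true⇒< v m q) (≢⇒≡ᵇ≡false (ℕₚ.>⇒≢ (<ᵇ≡true⇒< a v p))))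

  lnestTail-good : lnestTail (suc m) (suc a) xs ≡ a
  lnestTail-good = trans (Σℕ-cong N λ v _ → cong bit (drop v))
    (Σℕ-below (ℕₚ.≤-trans (ℕₚ.<⇒≤ a<m) (ℕₚ.≤-trans (ℕₚ.n≤1+n m) (ℕₚ.m≤m+n (suc m) _))))
    where
    drop : ∀ v → mem (suc v) xs ∧ (v <ᵇ a) ≡ (v <ᵇ a)
    drop v with v <ᵇ a in p
    ... | false = 𝔹ₚ.∧-zeroʳ _
    ... | true  = cong (_∧ true)
      (used (ℕₚ.<-trans (<ᵇ≡true⇒< v a p) a<m) (≢⇒≡ᵇ≡false (ℕₚ.<⇒≢ (<ᵇ≡true⇒< v a p))))

≡ᵇ-+ : ∀ i a b → (i ℕ.+ a ≡ᵇ i ℕ.+ b) ≡ (a ≡ᵇ b)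
≡ᵇ-+ zero a b = refl
≡ᵇ-+ (suc i) a b = ≡ᵇ-+ i a b

-- For an arc to the t-th letter above its position, the two inner sums are its crossings and its
-- nestings. Their total is the number of choices less one, whichever choice is made.
Σℕ-others : ∀ {k t} (U : ℕ → Bool) → t < k → U t ≡ true →
  suc (Σℕ k (λ s → bit (U s ∧ (s <ᵇ t))) ℕ.+ Σℕ k (λ s → bit (U s ∧ (t <ᵇ s)))) ≡ Σℕ k (bit ∘ U)
Σℕ-others {k} {t} U t<k Ut = begin
  suc (Σℕ k below ℕ.+ Σℕ k above)
    ≡⟨ cong₂ ℕ._+_ (sym (trans (Σℕ-cong k λ s _ → cong bit (sym (𝔹ₚ.∧-identityʳ (s ≡ᵇ t)))) (Σℕ-≡ᵇ t<k true)))
                   (sym (Σℕ-+ k below above)) ⟩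
  Σℕ k (λ s → bit (s ≡ᵇ t)) ℕ.+ Σℕ k (λ s → below s ℕ.+ above s)
    ≡⟨ sym (Σℕ-+ k (λ s → bit (s ≡ᵇ t)) (λ s → below s ℕ.+ above s)) ⟩
  Σℕ k (λ s → bit (s ≡ᵇ t) ℕ.+ (below s ℕ.+ above s))
    ≡⟨ Σℕ-cong k (λ s _ → trichotomy s) ⟩
  Σℕ k (bit ∘ U) ∎
  where
  open ≡-Reasoning
  below = λ s → bit (U s ∧ (s <ᵇ t))
  above = λ s → bit (U s ∧ (t <ᵇ s))
  trichotomy : ∀ s → bit (s ≡ᵇ t) ℕ.+ (below s ℕ.+ above s) ≡ bit (U s)
  trichotomy s with ℕₚ.<-cmp s t
  ... | tri< p q r rewrite ≢⇒≡ᵇ≡false q | <⇒<ᵇ≡true p | ≥⇒<ᵇ≡false {t} {s} (ℕₚ.<⇒≤ p)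
                         | 𝔹ₚ.∧-zeroʳ (U s) | 𝔹ₚ.∧-identityʳ (U s) = ℕₚ.+-identityʳ _
  ... | tri≈ p refl r rewrite ≡ᵇ-refl s | <ᵇ-irrefl s | 𝔹ₚ.∧-zeroʳ (U s) | Ut = refl
  ... | tri> p q r rewrite ≢⇒≡ᵇ≡false q | <⇒<ᵇ≡true r | ≥⇒<ᵇ≡false {s} {t} (ℕₚ.<⇒≤ r)
                         | 𝔹ₚ.∧-zeroʳ (U s) | 𝔹ₚ.∧-identityʳ (U s) = refl

-- Ring-valued sums over letters and words.

module Words {c ℓ : Level} (R : CommutativeRing c ℓ) where
  open CommutativeRing R
    using (Carrier; _≈_; _+_; _*_; 0#; 1#; setoid; +-commutativeMonoid; commutativeSemiring; +-cong;
      +-congˡ; +-congʳ; *-congʳ; +-identityˡ; +-identityʳ; *-identityʳ; +-assoc; +-comm; *-comm;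
      zeroˡ; distribʳ; reflexive)
    renaming (refl to ≈-refl; sym to ≈-sym; trans to ≈-trans)
  open RingDefs R
  open BigOp +-commutativeMonoid public using () renaming
    ( ⨁ to Σ#; ⨁-cong to Σ#-cong; ⨁-ε to Σ#-0; ⨁-∙ to Σ#-+; ⨁-skip to Σ#-skip
    ; ⨁-++ to Σ#-++; ⨁-last to Σ#-last; ⨁-comm to Σ#-comm; foldr-upTo to Σ#-upTo; foldr-range to Σ#-range)
  open import Relation.Binary.Reasoning.Setoid setoid
  open import Algebra.Solver.Ring.NaturalCoefficients.Default commutativeSemiring
    using (solve; _:*_; _:=_)

  Σ#-*ʳ : ∀ n g x → Σ# n (λ v → g v * x) ≈ Σ# n g * x
  Σ#-*ʳ zero g x = ≈-sym (zeroˡ x)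
  Σ#-*ʳ (suc n) g x = ≈-trans (+-congˡ (Σ#-*ʳ n _ x)) (≈-sym (distribʳ x _ _))

  Σ#-*ˡ : ∀ n g x → Σ# n (λ v → x * g v) ≈ x * Σ# n g
  Σ#-*ˡ n g x = ≈-trans (Σ#-cong n λ v _ → *-comm x (g v)) (≈-trans (Σ#-*ʳ n g x) (*-comm _ x))

  infix 8 ⟦_⟧_
  ⟦_⟧_ : Bool → Carrier → Carrier
  ⟦ b ⟧ x = if b then x else 0#

  ⟦⟧-cong : ∀ b {x y} → (b ≡ true → x ≈ y) → ⟦ b ⟧ x ≈ ⟦ b ⟧ y
  ⟦⟧-cong true  e = e refl
  ⟦⟧-cong false e = ≈-refl

  ⟦⟧-∧ : ∀ a b x → ⟦ a ∧ b ⟧ x ≈ ⟦ a ⟧ ⟦ b ⟧ x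
  ⟦⟧-∧ true  b x = ≈-refl
  ⟦⟧-∧ false b x = ≈-refl

  ⟦⟧-* : ∀ b x y → ⟦ b ⟧ (x * y) ≈ ⟦ b ⟧ x * y
  ⟦⟧-* true  x y = ≈-refl
  ⟦⟧-* false x y = ≈-sym (zeroˡ y)

  ⟦⟧-split : ∀ b x → x ≈ ⟦ b ⟧ x + ⟦ not b ⟧ x
  ⟦⟧-split true  x = ≈-sym (+-identityʳ x)
  ⟦⟧-split false x = ≈-sym (+-identityˡ x)

  ΣW : ℕ → ℕ → (List ℕ → Carrier) → Carrier
  ΣW N zero    F = F []
  ΣW N (suc k) F = Σ# N λ a → ΣW N k λ w → F (suc a ∷ w)

  ΣW-cong : ∀ N k {F G : List ℕ → Carrier} →
            (∀ w → length w ≡ k → InRange N w → F w ≈ G w) → ΣW N k F ≈ ΣW N k G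
  ΣW-cong N zero e = e [] refl []
  ΣW-cong N (suc k) e = Σ#-cong N λ a a<N →
    ΣW-cong N k λ w l r → e (suc a ∷ w) (cong suc l) ((s≤s z≤n , a<N) ∷ r)

  ΣW-0 : ∀ N k → ΣW N k (const 0#) ≈ 0#
  ΣW-0 N zero = ≈-refl
  ΣW-0 N (suc k) = ≈-trans (Σ#-cong N λ _ _ → ΣW-0 N k) (Σ#-0 N)

  ΣW-+ : ∀ N k (F G : List ℕ → Carrier) → ΣW N k (λ w → F w + G w) ≈ ΣW N k F + ΣW N k G
  ΣW-+ N zero F G = ≈-refl
  ΣW-+ N (suc k) F G = ≈-trans (Σ#-cong N λ a _ → ΣW-+ N k _ _) (Σ#-+ N _ _)

  ΣW-*ʳ : ∀ N k (F : List ℕ → Carrier) x → ΣW N k (λ w → F w * x) ≈ ΣW N k F * x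
  ΣW-*ʳ N zero F x = ≈-refl
  ΣW-*ʳ N (suc k) F x = ≈-trans (Σ#-cong N λ a _ → ΣW-*ʳ N k _ x) (Σ#-*ʳ N _ x)

  Σ#-ΣW : ∀ n N k (F : ℕ → List ℕ → Carrier) →
          Σ# n (λ a → ΣW N k (F a)) ≈ ΣW N k (λ w → Σ# n (λ a → F a w))
  Σ#-ΣW n N zero F = ≈-refl
  Σ#-ΣW n N (suc k) F = ≈-trans (Σ#-comm n N _) (Σ#-cong N λ b _ → Σ#-ΣW n N k _)

  ΣW-split : ∀ N k (b : List ℕ → Bool) F →
             ΣW N k F ≈ ΣW N k (λ w → ⟦ b w ⟧ F w) + ΣW N k (λ w → ⟦ not (b w) ⟧ F w)
  ΣW-split N k b F = ≈-trans (ΣW-cong N k λ w _ _ → ⟦⟧-split (b w) (F w)) (ΣW-+ N k _ _)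

  -- This deletes a letter inside a sum: `skip (suc r)` is a bijection from the smaller alphabet
  -- onto the letters other than `suc r`.
  ΣW-avoid : ∀ {N r} k (G : List ℕ → Carrier) → r ≤ N →
             ΣW (suc N) k (λ w → ⟦ not (mem (suc r) w) ⟧ G w) ≈ ΣW N k (G ∘ map (skip (suc r)))
  ΣW-avoid zero G r≤N = ≈-refl
  ΣW-avoid {N} {r} (suc k) G r≤N = begin
    Σ# (suc N) g′                    ≈⟨ Σ#-skip g′ r≤N ⟩
    g′ r + Σ# N (g′ ∘ skip r)         ≈⟨ +-cong g′r≈0 (Σ#-cong N λ a _ → g′-skip a) ⟩
    0# + ΣW N (suc k) (G ∘ map (skip (suc r))) ≈⟨ +-identityˡ _ ⟩
    ΣW N (suc k) (G ∘ map (skip (suc r))) ∎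
    where
    g′ = λ a → ΣW (suc N) k λ w → ⟦ not (mem (suc r) (suc a ∷ w)) ⟧ G (suc a ∷ w)
    g′r≈0 : g′ r ≈ 0#
    g′r≈0 = ≈-trans (ΣW-cong (suc N) k λ w _ _ →
      reflexive (cong (λ b → ⟦ not (b ∨ mem (suc r) w) ⟧ G (suc r ∷ w)) (≡ᵇ-refl r))) (ΣW-0 (suc N) k)
    g′-skip : ∀ a → g′ (skip r a) ≈ ΣW N k (λ w → G (suc (skip r a) ∷ map (skip (suc r)) w))
    g′-skip a = ≈-trans (ΣW-cong (suc N) k λ w _ _ →
      reflexive (cong (λ b → ⟦ not (b ∨ mem (suc r) w) ⟧ G (suc (skip r a) ∷ w)) (skip-avoids r a)))
      (ΣW-avoid k (λ w → G (suc (skip r a) ∷ w)) r≤N)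

  -- As `t` runs through the marked indices, its rank takes each value once. The offset `d` is there
  -- for the induction: taking off a marked last index lowers the number of marked indices above
  -- every other `t` by one, and `d` makes up for it.
  Σ#-rank : ∀ k (U : ℕ → Bool) (g : ℕ → ℕ → Carrier) d →
    Σ# k (λ t → ⟦ U t ⟧ g (Σℕ k (λ s → bit (U s ∧ (s <ᵇ t)))) (Σℕ k (λ s → bit (U s ∧ (t <ᵇ s))) ℕ.+ d))
    ≈ Σ# (Σℕ k (bit ∘ U)) (λ a → g (Σℕ k (bit ∘ U) ∸ suc a) (a ℕ.+ d))
  Σ#-rank zero U g d = ≈-refl
  Σ#-rank (suc k) U g d = begin
    Σ# (suc k) (λ t → ⟦ U t ⟧ g (below (suc k) t) (above (suc k) t ℕ.+ d))
      ≈⟨ Σ#-last k (λ t → ⟦ U t ⟧ g (below (suc k) t) (above (suc k) t ℕ.+ d)) ⟩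
    Σ# k (λ t → ⟦ U t ⟧ g (below (suc k) t) (above (suc k) t ℕ.+ d)) + ⟦ U k ⟧ g (below (suc k) k) (above (suc k) k ℕ.+ d)
      ≈⟨ +-cong (Σ#-cong k λ t t<k → reflexive (cong (⟦ U t ⟧_) (cong₂ g (below-last t<k) (trans (cong (ℕ._+ d) (above-last t<k)) (ℕₚ.+-assoc (above k t) (bit (U k)) d)))))
                (reflexive (cong (⟦ U k ⟧_) (cong₂ (λ a b → g a (b ℕ.+ d)) below-top above-top))) ⟩
    Σ# k (λ t → ⟦ U t ⟧ g (below k t) (above k t ℕ.+ (bit (U k) ℕ.+ d))) + ⟦ U k ⟧ g (#U k) d
      ≈⟨ +-congʳ (Σ#-rank k U g (bit (U k) ℕ.+ d)) ⟩
    Σ# (#U k) (λ a → g (#U k ∸ suc a) (a ℕ.+ (bit (U k) ℕ.+ d))) + ⟦ U k ⟧ g (#U k) d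
      ≈⟨ top (U k) ⟩
    Σ# (#U k ℕ.+ bit (U k)) (λ a → g (#U k ℕ.+ bit (U k) ∸ suc a) (a ℕ.+ d))
      ≡⟨ cong (λ n → Σ# n (λ a → g (n ∸ suc a) (a ℕ.+ d))) (Σℕ-last k (bit ∘ U)) ⟨
    Σ# (#U (suc k)) (λ a → g (#U (suc k) ∸ suc a) (a ℕ.+ d)) ∎
    where
    #U = λ n → Σℕ n (bit ∘ U)
    below above : ℕ → ℕ → ℕ
    below n t = Σℕ n (λ s → bit (U s ∧ (s <ᵇ t)))
    above n t = Σℕ n (λ s → bit (U s ∧ (t <ᵇ s)))
    below-last : ∀ {t} → t < k → below (suc k) t ≡ below k t
    below-last {t} t<k = trans (Σℕ-last k (λ s → bit (U s ∧ (s <ᵇ t))))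
      (trans (cong (λ b → below k t ℕ.+ bit b) (∧-falseʳ {U k} (≥⇒<ᵇ≡false (ℕₚ.<⇒≤ t<k)))) (ℕₚ.+-identityʳ _))
    above-last : ∀ {t} → t < k → above (suc k) t ≡ above k t ℕ.+ bit (U k)
    above-last {t} t<k = trans (Σℕ-last k (λ s → bit (U s ∧ (t <ᵇ s))))
      (cong (λ b → above k t ℕ.+ bit b) (trans (cong (U k ∧_) (<⇒<ᵇ≡true t<k)) (𝔹ₚ.∧-identityʳ (U k))))
    below-top : below (suc k) k ≡ #U k
    below-top = trans (Σℕ-last k (λ s → bit (U s ∧ (s <ᵇ k))))
      (trans (cong₂ ℕ._+_ (Σℕ-cong k λ s s<k → cong bit (trans (cong (U s ∧_) (<⇒<ᵇ≡true s<k)) (𝔹ₚ.∧-identityʳ (U s))))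
        (cong bit (∧-falseʳ {U k} (<ᵇ-irrefl k)))) (ℕₚ.+-identityʳ _))
    above-top : above (suc k) k ≡ 0
    above-top = trans (Σℕ-cong (suc k) λ { s (s≤s s≤k) → cong bit (∧-falseʳ {U s} (≥⇒<ᵇ≡false s≤k)) }) (Σℕ-0 (suc k))
    top : ∀ b → Σ# (#U k) (λ a → g (#U k ∸ suc a) (a ℕ.+ (bit b ℕ.+ d))) + ⟦ b ⟧ g (#U k) d
              ≈ Σ# (#U k ℕ.+ bit b) (λ a → g (#U k ℕ.+ bit b ∸ suc a) (a ℕ.+ d))
    top false rewrite ℕₚ.+-identityʳ (#U k) = +-identityʳ _
    top true rewrite ℕₚ.+-comm (#U k) 1 = ≈-trans (+-comm _ _)
      (+-congˡ (Σ#-cong (#U k) λ a _ → reflexive (cong (g (#U k ∸ suc a)) (ℕₚ.+-suc a d))))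

  Σ#-⟦⟧1 : ∀ k (U : ℕ → Bool) → Σ# k (λ t → ⟦ U t ⟧ 1#) ≈ fromℕ (Σℕ k (bit ∘ U))
  Σ#-⟦⟧1 zero U = ≈-refl
  Σ#-⟦⟧1 (suc k) U with U 0
  ... | true  = +-congˡ (Σ#-⟦⟧1 k (U ∘ suc))
  ... | false = ≈-trans (+-identityˡ _) (Σ#-⟦⟧1 k (U ∘ suc))

  Σ#-marked : ∀ k (U : ℕ → Bool) {z c} x → z < k → U z ≡ true → Σℕ k (bit ∘ U) ≡ suc c →
    Σ# k (λ t → ⟦ U t ⟧ (if t ≡ᵇ z then x else 1#)) ≈ x + fromℕ c
  Σ#-marked (suc k) U {z} {c} x (s≤s z≤k) Uz #U = begin
    Σ# (suc k) g′                  ≈⟨ Σ#-skip g′ z≤k ⟩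
    g′ z + Σ# k (g′ ∘ skip z)       ≈⟨ +-cong (reflexive (cong₂ (λ a b → ⟦ a ⟧ (if b then x else 1#)) Uz (≡ᵇ-refl z)))
                                       (Σ#-cong k λ t _ → reflexive (cong (λ b → ⟦ U (skip z t) ⟧ (if b then x else 1#))
                                         (trans (≡ᵇ-sym (skip z t) z) (skip-avoids z t)))) ⟩
    x + Σ# k (λ t → ⟦ U (skip z t) ⟧ 1#) ≈⟨ +-congˡ (Σ#-⟦⟧1 k (U ∘ skip z)) ⟩
    x + fromℕ (Σℕ k (bit ∘ U ∘ skip z)) ≡⟨ cong (λ n → x + fromℕ n) (ℕₚ.suc-injective (trans (sym #U-skip) #U)) ⟩
    x + fromℕ c ∎
    where
    g′ = λ t → ⟦ U t ⟧ (if t ≡ᵇ z then x else 1#)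
    #U-skip : Σℕ (suc k) (bit ∘ U) ≡ suc (Σℕ k (bit ∘ U ∘ skip z))
    #U-skip = trans (Σℕ-skip (bit ∘ U) z≤k) (cong (λ b → bit b ℕ.+ Σℕ k (bit ∘ U ∘ skip z)) Uz)

  sumL-upTo : ∀ n h → sumL (map h (upTo n)) ≡ Σ# n h
  sumL-upTo n h = trans (Lₚ.foldr-map _ _ _ (upTo n)) (Σ#-upTo n id h)

  -- An arc with `a` crossings and `b` nestings; `b = 0` is the case of an exclusive record or
  -- antirecord.
  arcWeight : (x u p q : Carrier) → ℕ → ℕ → Carrier
  arcWeight x u p q a b = pow p a * pow q b * (if b ≡ᵇ 0 then x else u)

  -- The term without nestings stands alone; each of the others contains a factor `q`, and what is
  -- left of them is `qint p q m`.
  Σ#-arcWeight : ∀ x u p q m →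
    Σ# (suc m) (λ a → arcWeight x u p q (m ∸ a) a) ≈ pow p m * x + q * qint p q m * u
  Σ#-arcWeight x u p q m = +-cong (*-congʳ (*-identityʳ _)) (begin
    Σ# m (λ a → pow p (m ∸ suc a) * (q * pow q a) * u)
      ≈⟨ Σ#-cong m (λ a _ → ≈-trans
           (solve 4 (λ P q Q u → P :* (q :* Q) :* u := P :* Q :* (q :* u)) ≈-refl (pow p (m ∸ suc a)) q (pow q a) u)
           (*-congʳ (*-congʳ (reflexive (cong (pow p) (sym (ℕₚ.∸-+-assoc m 1 a))))))) ⟩
    Σ# m (λ a → pow p (m ∸ 1 ∸ a) * pow q a * (q * u))
      ≈⟨ Σ#-*ʳ m _ (q * u) ⟩
    Σ# m (λ a → pow p (m ∸ 1 ∸ a) * pow q a) * (q * u)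
      ≡⟨ cong (_* (q * u)) (sumL-upTo m _) ⟨
    qint p q m * (q * u)
      ≈⟨ solve 3 (λ Q q u → Q :* (q :* u) := q :* Q :* u) ≈-refl (qint p q m) q u ⟩
    q * qint p q m * u ∎)

-- The recursion over heights.

module Scan {c ℓ : Level} (R : CommutativeRing c ℓ) (V : RingDefs.Vars R) where
  open CommutativeRing R
    using (Carrier; _≈_; _+_; _*_; 0#; 1#; setoid; commutativeSemiring; +-cong; +-congˡ; *-cong; *-congˡ;
      *-congʳ; +-identityʳ; *-identityˡ; *-identityʳ; +-comm; *-assoc; *-comm; zeroˡ; zeroʳ;
      reflexive)
    renaming (refl to ≈-refl; sym to ≈-sym; trans to ≈-trans)
  open RingDefs R
  open Vars V
  open Words R
  open import Relation.Binary.Reasoning.Setoid setoid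
  open import Algebra.Solver.Ring.NaturalCoefficients.Default commutativeSemiring
    using (solve; _:+_; _:*_; _:=_; con)

  -- The Booleans tell whether σ(i) < i, i < σ(i), i < σ⁻¹(i), and whether i
  -- is the least element of its cycle.
  vertexWeight : (lower upper hit closing : Bool) (lc ln uc un g : ℕ) → Carrier
  vertexWeight lower upper hit closing lc ln uc un g =
    (if lower then (if hit then arcWeight x₂ u₂ p₋₂ q₋₂ lc ln else arcWeight x₁ u₁ p₋₁ q₋₁ lc ln)
     else if upper then (if hit then arcWeight y₁ v₁ p₊₁ q₊₁ uc un else arcWeight y₂ v₂ p₊₂ q₊₂ uc un)
     else w g * pow s g)
    * (if closing then lam else 1#)

  -- The arc from `i` to `x` closes a cycle exactly when `x` is the start of the path ending in `i`.
  -- The other vertices of that cycle are later positions, so `i` is its least element.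
  headWeight : ℕ → ℕ → List ℕ → Carrier
  headWeight i x xs = vertexWeight (x <ᵇ i) (i <ᵇ x) (mem i xs) (x ≡ᵇ pathStart (suc i) xs i)
    (lcrossTail i x xs) (lnestTail i x xs) (ucrossTail i x xs) (unestTail i x xs) (gaps i xs)

  headWeight-fix : ∀ i x xs {c g} → (x <ᵇ i) ≡ false → (i <ᵇ x) ≡ false →
    (x ≡ᵇ pathStart (suc i) xs i) ≡ c → gaps i xs ≡ g →
    headWeight i x xs ≡ w g * pow s g * (if c then lam else 1#)
  headWeight-fix i x xs e₁ e₂ e₃ e₄ rewrite e₁ | e₂ | e₃ | e₄ = refl

  headWeight-lower : ∀ i x xs {h c a b} → (x <ᵇ i) ≡ true → mem i xs ≡ h →
    (x ≡ᵇ pathStart (suc i) xs i) ≡ c → lcrossTail i x xs ≡ a → lnestTail i x xs ≡ b →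
    headWeight i x xs ≡ (if h then arcWeight x₂ u₂ p₋₂ q₋₂ a b else arcWeight x₁ u₁ p₋₁ q₋₁ a b)
                      * (if c then lam else 1#)
  headWeight-lower i x xs e₁ refl e₃ e₄ e₅ rewrite e₁ | e₃ | e₄ | e₅ = refl

  headWeight-upper : ∀ i x xs {h c a b} → (x <ᵇ i) ≡ false → (i <ᵇ x) ≡ true → mem i xs ≡ h →
    (x ≡ᵇ pathStart (suc i) xs i) ≡ c → ucrossTail i x xs ≡ a → unestTail i x xs ≡ b →
    headWeight i x xs ≡ (if h then arcWeight y₁ v₁ p₊₁ q₊₁ a b else arcWeight y₂ v₂ p₊₂ q₊₂ a b)
                      * (if c then lam else 1#)
  headWeight-upper i x xs e₁ e₂ refl refl e₃ e₄ rewrite e₁ | e₂ | e₃ | e₄ = refl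

  wordWeight : ℕ → List ℕ → Carrier
  wordWeight m []       = 1#
  wordWeight m (x ∷ xs) = headWeight (suc m) x xs * wordWeight (suc m) xs

  closing-skip : ∀ {i r} x xs → r < i → let φ = skip (suc r) in
    (φ x ≡ᵇ pathStart (suc (suc i)) (map φ xs) (suc i)) ≡ (x ≡ᵇ pathStart (suc i) xs i)
  closing-skip {i} {r} x xs r<i = trans
    (cong (λ v → skip (suc r) x ≡ᵇ pathStart (suc (suc i)) (map (skip (suc r)) xs) v) (sym (skip-≥ r<i)))
    (trans (cong (skip (suc r) x ≡ᵇ_) (pathStart-skip xs i (ℕₚ.m≤n⇒m≤1+n r<i))) (skip-≡ᵇ (suc r) x _))

  headWeight-skip : ∀ {i r} x xs → r < i →
    headWeight (suc i) (skip (suc r) x) (map (skip (suc r)) xs) ≡ headWeight i x xs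
  headWeight-skip {i} {r} x xs r<i
    rewrite skip-<ᵇʳ {suc r} {i} x r<i | skip-<ᵇˡ {suc r} {i} x r<i | skip-mem-pos {suc r} {i} xs r<i
          | closing-skip x xs r<i
          | lcrossTail-skip r<i x xs | lnestTail-skip r<i x xs
          | ucrossTail-skip r<i x xs | unestTail-skip r<i x xs | gaps-skip r<i x xs = refl

  -- The deleted letter `suc r` is smaller than every position of the word, so that all positions
  -- move down with the letters and the word starts at `suc m` instead of `suc (suc m)`.
  wordWeight-skip : ∀ {m r} xs → r ≤ m → wordWeight (suc m) (map (skip (suc r)) xs) ≡ wordWeight m xs
  wordWeight-skip [] p = refl
  wordWeight-skip (x ∷ xs) p =
    cong₂ _*_ (headWeight-skip x xs (s≤s p)) (wordWeight-skip xs (ℕₚ.m≤n⇒m≤1+n p))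

  -- This will be the weighted sum over Motzkin paths with `k` steps from height `m` to height 0.
  -- For `m = 0` no letter is required, so that the words are the permutations of 1, ..., k.
  goodSum : ℕ → ℕ → Carrier
  goodSum k m = ΣW (m ℕ.+ k) k λ w → ⟦ good m w ⟧ wordWeight m w

  good-skip : ∀ {m r} xs → m ≤ r → good m (map (skip (suc r)) xs) ≡ good m xs
  good-skip {m} {r} xs p = cong₂ _∧_ (distinct-skip (suc r) xs) (full-skip-large m r xs p)

  avoid-top : ∀ k m x →
    ΣW (suc (m ℕ.+ k)) k (λ w → ⟦ not (mem (suc m) w) ⟧ ⟦ good m w ⟧ (wordWeight (suc m) w * x))
    ≈ goodSum k m * x
  avoid-top k m x = begin
    ΣW (suc (m ℕ.+ k)) k (λ w → ⟦ not (mem (suc m) w) ⟧ ⟦ good m w ⟧ (wordWeight (suc m) w * x))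
      ≈⟨ ΣW-avoid k (λ w → ⟦ good m w ⟧ (wordWeight (suc m) w * x)) (ℕₚ.m≤m+n m k) ⟩
    ΣW (m ℕ.+ k) k (λ w → ⟦ good m (map (skip (suc m)) w) ⟧ (wordWeight (suc m) (map (skip (suc m)) w) * x))
      ≈⟨ ΣW-cong (m ℕ.+ k) k (λ w _ _ → ≈-trans
           (reflexive (cong₂ (λ b y → ⟦ b ⟧ (y * x)) (good-skip w ℕₚ.≤-refl) (wordWeight-skip w ℕₚ.≤-refl)))
           (⟦⟧-* (good m w) _ x)) ⟩
    ΣW (m ℕ.+ k) k (λ w → ⟦ good m w ⟧ wordWeight m w * x)
      ≈⟨ ΣW-*ʳ (m ℕ.+ k) k _ x ⟩
    goodSum k m * x ∎

  -- If the tail uses `suc m`, this letter joins the required ones and the tail has height m + 1. If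
  -- not, it is deleted and the height is m.
  split-top : ∀ k m x y →
    ΣW (suc (m ℕ.+ k)) k (λ w → ⟦ good m w ⟧ (wordWeight (suc m) w * (if mem (suc m) w then x else y)))
    ≈ goodSum k (suc m) * x + goodSum k m * y
  split-top k m x y = begin
    ΣW N k F
      ≈⟨ ΣW-split N k (mem (suc m)) F ⟩
    ΣW N k (λ w → ⟦ mem (suc m) w ⟧ F w) + ΣW N k (λ w → ⟦ not (mem (suc m) w) ⟧ F w)
      ≈⟨ +-cong (ΣW-cong N k λ w _ _ → hit w) (ΣW-cong N k λ w _ _ → missed w) ⟩
    ΣW N k (λ w → ⟦ good (suc m) w ⟧ wordWeight (suc m) w * x)
      + ΣW N k (λ w → ⟦ not (mem (suc m) w) ⟧ ⟦ good m w ⟧ (wordWeight (suc m) w * y))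
      ≈⟨ +-cong (ΣW-*ʳ N k _ x) (avoid-top k m y) ⟩
    goodSum k (suc m) * x + goodSum k m * y ∎
    where
    N = suc (m ℕ.+ k)
    F = λ w → ⟦ good m w ⟧ (wordWeight (suc m) w * (if mem (suc m) w then x else y))
    good-suc : ∀ w → good (suc m) w ≡ good m w ∧ mem (suc m) w
    good-suc w = trans (cong (distinctB w ∧_) (⋀-last m (λ v → mem (suc v) w)))
                       (sym (𝔹ₚ.∧-assoc (distinctB w) _ _))
    hit : ∀ w → ⟦ mem (suc m) w ⟧ F w ≈ ⟦ good (suc m) w ⟧ wordWeight (suc m) w * x
    hit w rewrite good-suc w with mem (suc m) w
    ... | true  rewrite 𝔹ₚ.∧-identityʳ (good m w) = ⟦⟧-* (good m w) _ x
    ... | false rewrite 𝔹ₚ.∧-zeroʳ (good m w) = ≈-sym (zeroˡ x)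
    missed : ∀ w → ⟦ not (mem (suc m) w) ⟧ F w
                 ≈ ⟦ not (mem (suc m) w) ⟧ ⟦ good m w ⟧ (wordWeight (suc m) w * y)
    missed w with mem (suc m) w
    ... | true  = ≈-refl
    ... | false = ≈-refl

  summand : ℕ → ℕ → List ℕ → Carrier
  summand m a xs = ⟦ good m (suc a ∷ xs) ⟧ (headWeight (suc m) (suc a) xs * wordWeight (suc m) xs)

  private
    pathStart-≥ : ∀ i xs → distinctB xs ≡ true → i ≤ pathStart (suc i) xs i
    pathStart-≥ i xs d with mem i xs in e
    ... | true  = ℕₚ.<⇒≤ (pathStart-of-used (suc i) xs d e)
    ... | false = ℕₚ.≤-reflexive (sym (pathStart-of-unused (suc i) xs e))

  -- The tail does not use `suc m`, so the path ending there is trivial and the fixed point closes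
  -- it. The number of pseudo-nestings equals the height by `gaps-good`.
  fixSum : ∀ k m → ΣW (suc (m ℕ.+ k)) k (summand m m) ≈ goodSum k m * (w m * pow s m * lam)
  fixSum k m = ≈-trans (ΣW-cong (suc (m ℕ.+ k)) k pointwise) (avoid-top k m _)
    where
    pointwise : ∀ xs → length xs ≡ k → InRange (suc (m ℕ.+ k)) xs →
      summand m m xs ≈ ⟦ not (mem (suc m) xs) ⟧ ⟦ good m xs ⟧ (wordWeight (suc m) xs * (w m * pow s m * lam))
    pointwise xs refl r
      rewrite full-∷-large m m xs ℕₚ.≤-refl | 𝔹ₚ.∧-assoc (not (mem (suc m) xs)) (distinctB xs) (full m xs)
      = ≈-trans (⟦⟧-∧ (not (mem (suc m) xs)) (good m xs) _)
        (⟦⟧-cong (not (mem (suc m) xs)) λ e → ⟦⟧-cong (good m xs) λ g →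
          ≈-trans (*-congʳ (reflexive (value (not-true⁻ e) (∧-true⁻ˡ g) (∧-true⁻ʳ {distinctB xs} g)))) (*-comm _ _))
      where
      value : mem (suc m) xs ≡ false → distinctB xs ≡ true → full m xs ≡ true →
              headWeight (suc m) (suc m) xs ≡ w m * pow s m * lam
      value e d f = headWeight-fix (suc m) (suc m) xs (<ᵇ-irrefl (suc m)) (<ᵇ-irrefl (suc m))
        (trans (cong (suc m ≡ᵇ_) (pathStart-of-unused (suc (suc m)) xs e)) (≡ᵇ-refl m))
        (trans (gaps-good m xs d r f) (trans (cong (λ b → m ℕ.+ bit b) e) (ℕₚ.+-identityʳ m)))

  -- Deleting the chosen letter brings the height from m + 1 to m. Then `split-top` separates the
  -- double fall, where the position itself is a used letter and restores the height, from the peak,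
  -- where it is deleted as well.
  lowerSum : ∀ k m a → a ≤ m →
    ΣW (suc (suc m ℕ.+ k)) k (summand (suc m) a)
    ≈ goodSum k (suc m) * arcWeight x₂ u₂ p₋₂ q₋₂ (m ∸ a) a + goodSum k m * arcWeight x₁ u₁ p₋₁ q₋₁ (m ∸ a) a
  lowerSum k m a a≤m = begin
    ΣW (suc (suc m ℕ.+ k)) k (summand (suc m) a)
      ≈⟨ ΣW-cong (suc (suc m ℕ.+ k)) k (λ xs _ _ → pointwise xs) ⟩
    ΣW (suc (suc m ℕ.+ k)) k (λ xs → ⟦ not (mem (suc a) xs) ⟧ G xs)
      ≈⟨ ΣW-avoid k G (ℕₚ.≤-trans a≤m (ℕₚ.≤-trans (ℕₚ.n≤1+n m) (ℕₚ.m≤m+n (suc m) k))) ⟩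
    ΣW (suc m ℕ.+ k) k (G ∘ map (skip (suc a)))
      ≈⟨ ΣW-cong (suc m ℕ.+ k) k (λ xs _ _ → reflexive (G-skip xs)) ⟩
    ΣW (suc (m ℕ.+ k)) k (λ xs → ⟦ good m xs ⟧ (wordWeight (suc m) xs * (if mem (suc m) xs then c₂ else c₁)))
      ≈⟨ split-top k m c₂ c₁ ⟩
    goodSum k (suc m) * c₂ + goodSum k m * c₁ ∎
    where
    c₁ = arcWeight x₁ u₁ p₋₁ q₋₁ (m ∸ a) a
    c₂ = arcWeight x₂ u₂ p₋₂ q₋₂ (m ∸ a) a
    G : List ℕ → Carrier
    G xs = ⟦ distinctB xs ∧ full (suc m) (suc a ∷ xs) ⟧
           (wordWeight (suc (suc m)) xs * (if mem (suc (suc m)) xs then c₂ else c₁))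
    value : ∀ xs → distinctB xs ≡ true → full (suc m) (suc a ∷ xs) ≡ true →
            headWeight (suc (suc m)) (suc a) xs ≡ (if mem (suc (suc m)) xs then c₂ else c₁) * 1#
    value xs d f = headWeight-lower (suc (suc m)) (suc a) xs (<⇒<ᵇ≡true (s≤s a≤m)) refl
      -- No cycle closes: the path that ends in this position starts there or later, whereas `suc a`
      -- is smaller.
      (≢⇒≡ᵇ≡false (ℕₚ.<⇒≢ (ℕₚ.<-≤-trans (s≤s (s≤s a≤m)) (pathStart-≥ (suc (suc m)) xs d))))
      (lcrossTail-good xs (s≤s a≤m) f) (lnestTail-good xs (s≤s a≤m) f)
    pointwise : ∀ xs → summand (suc m) a xs ≈ ⟦ not (mem (suc a) xs) ⟧ G xs
    pointwise xs = ≈-trans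
      (reflexive (cong (λ b → ⟦ b ⟧ (headWeight (suc (suc m)) (suc a) xs * wordWeight (suc (suc m)) xs))
        (𝔹ₚ.∧-assoc (not (mem (suc a) xs)) (distinctB xs) (full (suc m) (suc a ∷ xs)))))
      (≈-trans (⟦⟧-∧ (not (mem (suc a) xs)) (distinctB xs ∧ full (suc m) (suc a ∷ xs)) _)
        (⟦⟧-cong (not (mem (suc a) xs)) λ _ → ⟦⟧-cong (distinctB xs ∧ full (suc m) (suc a ∷ xs)) λ g →
          ≈-trans (*-comm _ _) (*-congˡ (≈-trans (reflexive (value xs (∧-true⁻ˡ g) (∧-true⁻ʳ {distinctB xs} g))) (*-identityʳ _)))))
    G-skip : ∀ xs → G (map (skip (suc a)) xs)
           ≡ ⟦ good m xs ⟧ (wordWeight (suc m) xs * (if mem (suc m) xs then c₂ else c₁))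
    G-skip xs rewrite distinct-skip (suc a) xs | full-∷-small m a xs a≤m
                    | wordWeight-skip xs (ℕₚ.m≤n⇒m≤1+n a≤m) | skip-mem-pos {suc a} {suc m} xs (s≤s a≤m) = refl

  valleyWeight riseWeight : ℕ → Carrier
  valleyWeight m = (lam + fromℕ m) * (pow p₊₁ m * y₁)
  riseWeight m = Σ# m λ a → arcWeight y₂ v₂ p₊₂ q₊₂ (m ∸ suc a) a

  -- The argument is the height after the step. A double fall stays at m and has m letters to choose
  -- from; a peak leads from m + 1 to m and has m + 1.
  fallWeight peakWeight : ℕ → Carrier
  fallWeight m = Σ# m λ a → arcWeight x₂ u₂ p₋₂ q₋₂ (m ∸ suc a) a
  peakWeight m = Σ# (suc m) λ a → arcWeight x₁ u₁ p₋₁ q₋₁ (m ∸ a) a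

  levelWeight : ℕ → Carrier
  levelWeight m = fallWeight m + riseWeight m + w m * pow s m * lam

  pow-+ : ∀ x a b → pow x (a ℕ.+ b) ≈ pow x a * pow x b
  pow-+ x zero b = ≈-sym (*-identityˡ _)
  pow-+ x (suc a) b = ≈-trans (*-congˡ (pow-+ x a b)) (≈-sym (*-assoc _ _ _))

  pow-cong : ∀ {x y} a → x ≈ y → pow x a ≈ pow y a
  pow-cong zero e = ≈-refl
  pow-cong (suc a) e = *-cong e (pow-cong a e)

  module _ (v₁≈y₁ : v₁ ≈ y₁) (q₊₁≈p₊₁ : q₊₁ ≈ p₊₁) where

    -- The specialisation enters here only. It makes the weight a function of `a + b`, which
    -- `Σℕ-others` shows to be the same for all choices of the letter.
    arcWeight-valley : ∀ a b → arcWeight y₁ v₁ p₊₁ q₊₁ a b ≈ pow p₊₁ (a ℕ.+ b) * y₁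
    arcWeight-valley a b = *-cong
      (≈-trans (*-congˡ (pow-cong b q₊₁≈p₊₁)) (≈-sym (pow-+ p₊₁ a b))) (record-irrelevant (b ≡ᵇ 0))
      where
      record-irrelevant : ∀ c → (if c then y₁ else v₁) ≈ y₁
      record-irrelevant true  = ≈-refl
      record-irrelevant false = v₁≈y₁

    headSum-missed : ∀ m xs → InRange (suc m ℕ.+ length xs) xs → distinctB xs ≡ true → full m xs ≡ true → mem (suc m) xs ≡ false →
      Σ# (length xs) (λ t → ⟦ free (suc m) xs t ⟧ headWeight (suc m) (suc (suc m ℕ.+ t)) xs)
      ≈ riseWeight m
    headSum-missed m xs r d f e = begin
      Σ# k (λ t → ⟦ U t ⟧ headWeight (suc m) (suc (suc m ℕ.+ t)) xs)
        ≈⟨ Σ#-cong k (λ t _ → ⟦⟧-cong (U t) λ _ → ≈-trans (reflexive (headWeight-upper (suc m) (suc (suc m ℕ.+ t)) xs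
             (≥⇒<ᵇ≡false (ℕₚ.≤-trans (ℕₚ.m≤m+n m t) (ℕₚ.n≤1+n _))) (<ᵇ-suc-+ m t) e (closes t)
             (ucrossTail-free (suc m) xs t) (trans (unestTail-free (suc m) xs t) (sym (ℕₚ.+-identityʳ _)))))
             (*-identityʳ _)) ⟩
      Σ# k (λ t → ⟦ U t ⟧ g (Σℕ k (λ s → bit (U s ∧ (s <ᵇ t)))) (Σℕ k (λ s → bit (U s ∧ (t <ᵇ s))) ℕ.+ 0))
        ≈⟨ Σ#-rank k U g 0 ⟩
      Σ# (Σℕ k (bit ∘ U)) (λ a → g (Σℕ k (bit ∘ U) ∸ suc a) (a ℕ.+ 0))
        ≡⟨ cong (λ n → Σ# n (λ a → g (n ∸ suc a) (a ℕ.+ 0))) #U ⟩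
      Σ# m (λ a → g (m ∸ suc a) (a ℕ.+ 0))
        ≈⟨ Σ#-cong m (λ a _ → reflexive (cong (g (m ∸ suc a)) (ℕₚ.+-identityʳ a))) ⟩
      riseWeight m ∎
      where
      k = length xs
      U = free (suc m) xs
      g = arcWeight y₂ v₂ p₊₂ q₊₂
      #U : Σℕ k (bit ∘ U) ≡ m
      #U = trans (sym (gaps-free (suc m) xs)) (trans (gaps-good m xs d r f)
             (trans (cong (λ b → m ℕ.+ bit b) e) (ℕₚ.+-identityʳ m)))
      closes : ∀ t → (suc (suc m ℕ.+ t) ≡ᵇ pathStart (suc (suc m)) xs (suc m)) ≡ false
      closes t = trans (cong (suc (suc m ℕ.+ t) ≡ᵇ_) (pathStart-of-unused (suc (suc m)) xs e))
                       (≢⇒≡ᵇ≡false (ℕₚ.>⇒≢ (s≤s (s≤s (ℕₚ.m≤m+n m t)))))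

    headSum-hit : ∀ m xs → InRange (suc m ℕ.+ length xs) xs → distinctB xs ≡ true → full m xs ≡ true → mem (suc m) xs ≡ true →
      Σ# (length xs) (λ t → ⟦ free (suc m) xs t ⟧ headWeight (suc m) (suc (suc m ℕ.+ t)) xs)
      ≈ valleyWeight m
    headSum-hit m xs r d f e with ℕₚ.m≤n⇒∃[o]m+o≡n (pathStart-of-used (suc (suc m)) xs d e)
    ... | z , ≡Z = begin
      Σ# k (λ t → ⟦ U t ⟧ headWeight (suc m) (suc (suc m ℕ.+ t)) xs)
        ≈⟨ Σ#-cong k (λ t t<k → ≈-trans (⟦⟧-cong (U t) (value t t<k))
             (≈-trans (⟦⟧-cong (U t) λ _ → *-comm _ _) (⟦⟧-* (U t) _ _))) ⟩
      Σ# k (λ t → ⟦ U t ⟧ (if t ≡ᵇ z then lam else 1#) * (pow p₊₁ m * y₁))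
        ≈⟨ Σ#-*ʳ k _ _ ⟩
      Σ# k (λ t → ⟦ U t ⟧ (if t ≡ᵇ z then lam else 1#)) * (pow p₊₁ m * y₁)
        ≈⟨ *-congʳ (Σ#-marked k U lam z<k Uz #U) ⟩
      valleyWeight m ∎
      where
      k = length xs
      U = free (suc m) xs
      Z = pathStart (suc (suc m)) xs (suc m)
      #U : Σℕ k (bit ∘ U) ≡ suc m
      #U = trans (sym (gaps-free (suc m) xs)) (trans (gaps-good m xs d r f)
             (trans (cong (λ b → m ℕ.+ bit b) e) (ℕₚ.+-comm m 1)))
      z<k : z < k
      z<k = ℕₚ.+-cancelˡ-< (suc (suc m)) z k (subst (_< suc (suc m) ℕ.+ k) (sym ≡Z)
              (pathStart-≤ (suc (suc m)) xs (ℕₚ.m≤m+n (suc (suc m)) k)))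
      Uz : U z ≡ true
      Uz = cong not (trans (cong (λ v → mem v xs) ≡Z) (pathStart-unused (suc (suc m)) xs ℕₚ.≤-refl))
      value : ∀ t → t < k → U t ≡ true →
        headWeight (suc m) (suc (suc m ℕ.+ t)) xs ≈ pow p₊₁ m * y₁ * (if t ≡ᵇ z then lam else 1#)
      value t t<k Ut = ≈-trans
        (reflexive (headWeight-upper (suc m) (suc (suc m ℕ.+ t)) xs
          (≥⇒<ᵇ≡false (ℕₚ.≤-trans (ℕₚ.m≤m+n m t) (ℕₚ.n≤1+n _))) (<ᵇ-suc-+ m t) e
          (trans (cong (suc (suc m ℕ.+ t) ≡ᵇ_) (sym ≡Z)) (≡ᵇ-+ m t z)) refl refl))
        (*-congʳ (≈-trans (arcWeight-valley (ucrossTail (suc m) (suc (suc m ℕ.+ t)) xs) (unestTail (suc m) (suc (suc m ℕ.+ t)) xs)) (*-congʳ (reflexive (cong (pow p₊₁) others)))))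
        where
        others : ucrossTail (suc m) (suc (suc m ℕ.+ t)) xs ℕ.+ unestTail (suc m) (suc (suc m ℕ.+ t)) xs ≡ m
        others = trans (cong₂ ℕ._+_ (ucrossTail-free (suc m) xs t) (unestTail-free (suc m) xs t))
                       (ℕₚ.suc-injective (trans (Σℕ-others U t<k Ut) #U))

    headSum : ∀ m xs → InRange (suc m ℕ.+ length xs) xs → distinctB xs ≡ true → full m xs ≡ true →
      Σ# (length xs) (λ t → ⟦ free (suc m) xs t ⟧ headWeight (suc m) (suc (suc m ℕ.+ t)) xs)
      ≈ (if mem (suc m) xs then valleyWeight m else riseWeight m)
    headSum m xs r d f = by-cases (mem (suc m) xs) (headSum-hit m xs r d f) (headSum-missed m xs r d f)
      where
      by-cases : ∀ b {x y z} → (b ≡ true → z ≈ x) → (b ≡ false → z ≈ y) → z ≈ (if b then x else y)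
      by-cases true  p q = p refl
      by-cases false p q = q refl

    -- A letter above the position is itself a later position and cannot be deleted. The letter is
    -- therefore summed over first, for a fixed tail; the result depends only on whether the tail
    -- uses `suc m`.
    upperSum : ∀ k m → Σ# k (λ t → ΣW (suc (m ℕ.+ k)) k (summand m (suc (m ℕ.+ t))))
             ≈ goodSum k (suc m) * valleyWeight m + goodSum k m * riseWeight m
    upperSum k m = begin
      Σ# k (λ t → ΣW N k (summand m (suc (m ℕ.+ t))))
        ≈⟨ Σ#-ΣW k N k (λ t → summand m (suc (m ℕ.+ t))) ⟩
      ΣW N k (λ xs → Σ# k (λ t → summand m (suc (m ℕ.+ t)) xs))
        ≈⟨ ΣW-cong N k pointwise ⟩
      ΣW N k (λ xs → ⟦ good m xs ⟧ (wordWeight (suc m) xs * (if mem (suc m) xs then valleyWeight m else riseWeight m)))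
        ≈⟨ split-top k m _ _ ⟩
      goodSum k (suc m) * valleyWeight m + goodSum k m * riseWeight m ∎
      where
      N = suc (m ℕ.+ k)
      regroup : ∀ b d f x y → ⟦ (b ∧ d) ∧ f ⟧ (x * y) ≈ ⟦ d ∧ f ⟧ (y * ⟦ b ⟧ x)
      regroup true  true  true  x y = *-comm x y
      regroup true  true  false x y = ≈-refl
      regroup true  false f     x y = ≈-refl
      regroup false true  true  x y = ≈-sym (zeroʳ y)
      regroup false true  false x y = ≈-refl
      regroup false false f     x y = ≈-refl
      Σ#-⟦⟧ : ∀ n b y (g : ℕ → Carrier) → Σ# n (λ t → ⟦ b ⟧ (y * g t)) ≈ ⟦ b ⟧ (y * Σ# n g)
      Σ#-⟦⟧ n true  y g = Σ#-*ˡ n g y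
      Σ#-⟦⟧ n false y g = Σ#-0 n
      pointwise : ∀ xs → length xs ≡ k → InRange N xs →
        Σ# k (λ t → summand m (suc (m ℕ.+ t)) xs)
        ≈ ⟦ good m xs ⟧ (wordWeight (suc m) xs * (if mem (suc m) xs then valleyWeight m else riseWeight m))
      pointwise xs refl r = ≈-trans
        (Σ#-cong (length xs) λ t _ → ≈-trans
          (reflexive (cong (λ b → ⟦ (free (suc m) xs t ∧ distinctB xs) ∧ b ⟧ (headWeight (suc m) (suc (suc (m ℕ.+ t))) xs * wordWeight (suc m) xs))
            (full-∷-large m (suc (m ℕ.+ t)) xs (ℕₚ.≤-trans (ℕₚ.m≤m+n m t) (ℕₚ.n≤1+n _)))))
          (regroup (free (suc m) xs t) (distinctB xs) (full m xs) _ _))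
        (≈-trans (Σ#-⟦⟧ (length xs) (good m xs) _ _)
          (⟦⟧-cong (good m xs) λ g → *-congˡ (headSum m xs r (∧-true⁻ˡ g) (∧-true⁻ʳ {distinctB xs} g))))

    private
      column : ∀ k m → ℕ → Carrier
      column k m a = ΣW (suc (m ℕ.+ k)) k (summand m a)

      goodSum-columns : ∀ k m → goodSum (suc k) m ≈ column k m m +
        (Σ# m (column k m) + Σ# k (λ t → column k m (suc (m ℕ.+ t))))
      goodSum-columns k m = begin
        goodSum (suc k) m
          ≡⟨ cong (λ N → ΣW N (suc k) (λ xs → ⟦ good m xs ⟧ wordWeight m xs)) (ℕₚ.+-suc m k) ⟩
        Σ# (suc (m ℕ.+ k)) (column k m)
          ≈⟨ Σ#-skip (column k m) (ℕₚ.m≤m+n m k) ⟩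
        column k m m + Σ# (m ℕ.+ k) (column k m ∘ skip m)
          ≈⟨ +-congˡ (≈-trans (Σ#-++ m k _) (+-cong
               (Σ#-cong m λ a a<m → reflexive (cong (column k m) (skip-< a<m)))
               (Σ#-cong k λ t _ → reflexive (cong (column k m) (skip-≥ (ℕₚ.m≤m+n m t)))))) ⟩
        column k m m + (Σ# m (column k m) + Σ# k (λ t → column k m (suc (m ℕ.+ t)))) ∎

    goodSum-step-0 : ∀ k → goodSum (suc k) 0 ≈ levelWeight 0 * goodSum k 0 + valleyWeight 0 * goodSum k 1
    goodSum-step-0 k = ≈-trans (goodSum-columns k 0) (≈-trans
      (+-cong (fixSum k 0) (+-congˡ (upperSum k 0)))
      (solve 5 (λ S0 S1 c r v → S0 :* c :+ (con 0 :+ (S1 :* v :+ S0 :* r)) := (con 0 :+ r :+ c) :* S0 :+ v :* S1)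
        ≈-refl (goodSum k 0) (goodSum k 1) (w 0 * pow s 0 * lam) (riseWeight 0) (valleyWeight 0)))

    goodSum-step : ∀ k m → goodSum (suc k) (suc m) ≈
      levelWeight (suc m) * goodSum k (suc m) + peakWeight m * goodSum k m + valleyWeight (suc m) * goodSum k (suc (suc m))
    goodSum-step k m = ≈-trans (goodSum-columns k (suc m)) (≈-trans
      (+-cong (fixSum k (suc m)) (+-cong lower (upperSum k (suc m))))
      (solve 8 (λ S0 S1 S2 c r v d p → S1 :* c :+ (S1 :* d :+ S0 :* p :+ (S2 :* v :+ S1 :* r)) := (d :+ r :+ c) :* S1 :+ p :* S0 :+ v :* S2)
        ≈-refl (goodSum k m) (goodSum k (suc m)) (goodSum k (suc (suc m))) (w (suc m) * pow s (suc m) * lam)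
        (riseWeight (suc m)) (valleyWeight (suc m)) (fallWeight (suc m)) (peakWeight m)))
      where
      lower : Σ# (suc m) (column k (suc m)) ≈ goodSum k (suc m) * fallWeight (suc m) + goodSum k m * peakWeight m
      lower = ≈-trans (Σ#-cong (suc m) λ { a (s≤s a≤m) → lowerSum k m a a≤m })
        (≈-trans (Σ#-+ (suc m) (λ a → goodSum k (suc m) * fall a) (λ a → goodSum k m * peak a))
          (+-cong (Σ#-*ˡ (suc m) fall _) (Σ#-*ˡ (suc m) peak _)))
        where
        fall peak : ℕ → Carrier
        fall a = arcWeight x₂ u₂ p₋₂ q₋₂ (m ∸ a) a
        peak a = arcWeight x₁ u₁ p₋₁ q₋₁ (m ∸ a) a

-- Convolution of series and the recursion satisfied by the J-fraction.

module JFraction {c ℓ : Level} (R : CommutativeRing c ℓ) where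
  open CommutativeRing R
    using (Carrier; _≈_; _+_; _*_; 0#; 1#; setoid; commutativeSemiring; +-cong; +-congˡ; +-congʳ; *-cong;
      *-congˡ; *-congʳ; +-identityʳ; *-identityˡ; +-comm; *-assoc; reflexive)
    renaming (refl to ≈-refl; sym to ≈-sym; trans to ≈-trans)
  open RingDefs R
  open Words R
  open import Relation.Binary.Reasoning.Setoid setoid
  open import Algebra.Solver.Ring.NaturalCoefficients.Default commutativeSemiring
    using (solve; _:+_; _:*_; _:=_; con)

  Series : Set c
  Series = ℕ → Carrier

  infixl 7 _⋆_
  _⋆_ : Series → Series → Series
  (f ⋆ g) n = Σ# (suc n) λ a → f a * g (n ∸ a)

  ⋆-cong : ∀ n {f f′ g g′ : Series} → (∀ i → f i ≈ f′ i) → (∀ i → g i ≈ g′ i) → (f ⋆ g) n ≈ (f′ ⋆ g′) n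
  ⋆-cong n p q = Σ#-cong (suc n) λ a _ → *-cong (p a) (q (n ∸ a))

  ⋆-linearˡ : ∀ n x y (f g h : Series) →
    ((λ i → x * f i + y * g i) ⋆ h) n ≈ x * (f ⋆ h) n + y * (g ⋆ h) n
  ⋆-linearˡ n x y f g h = begin
    Σ# (suc n) (λ a → (x * f a + y * g a) * h (n ∸ a))
      ≈⟨ Σ#-cong (suc n) (λ a _ → solve 5 (λ x f y g h → (x :* f :+ y :* g) :* h := x :* (f :* h) :+ y :* (g :* h))
           ≈-refl x (f a) y (g a) (h (n ∸ a))) ⟩
    Σ# (suc n) (λ a → x * (f a * h (n ∸ a)) + y * (g a * h (n ∸ a)))
      ≈⟨ Σ#-+ (suc n) (λ a → x * (f a * h (n ∸ a))) (λ a → y * (g a * h (n ∸ a))) ⟩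
    Σ# (suc n) (λ a → x * (f a * h (n ∸ a))) + Σ# (suc n) (λ a → y * (g a * h (n ∸ a)))
      ≈⟨ +-cong (Σ#-*ˡ (suc n) (λ a → f a * h (n ∸ a)) x) (Σ#-*ˡ (suc n) (λ a → g a * h (n ∸ a)) y) ⟩
    x * (f ⋆ h) n + y * (g ⋆ h) n ∎

  ⋆-assoc : ∀ n (f g h : Series) → ((f ⋆ g) ⋆ h) n ≈ (f ⋆ (g ⋆ h)) n
  ⋆-assoc zero f g h =
    solve 3 (λ f g h → (f :* g :+ con 0) :* h :+ con 0 := f :* (g :* h :+ con 0) :+ con 0) ≈-refl (f 0) (g 0) (h 0)
  ⋆-assoc (suc n) f g h = begin
    (f 0 * g 0 + 0#) * h (suc n) + (((f ⋆ g) ∘ suc) ⋆ h) n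
      ≈⟨ +-congˡ (⋆-cong n {(f ⋆ g) ∘ suc} {λ i → f 0 * g (suc i) + 1# * ((f ∘ suc) ⋆ g) i} {h} (λ i → +-congˡ (≈-sym (*-identityˡ _))) (λ _ → ≈-refl)) ⟩
    (f 0 * g 0 + 0#) * h (suc n) + ((λ i → f 0 * g (suc i) + 1# * ((f ∘ suc) ⋆ g) i) ⋆ h) n
      ≈⟨ +-congˡ (⋆-linearˡ n (f 0) 1# (g ∘ suc) ((f ∘ suc) ⋆ g) h) ⟩
    (f 0 * g 0 + 0#) * h (suc n) + (f 0 * ((g ∘ suc) ⋆ h) n + 1# * (((f ∘ suc) ⋆ g) ⋆ h) n)
      ≈⟨ +-congˡ (+-congˡ (*-congˡ (⋆-assoc n (f ∘ suc) g h))) ⟩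
    (f 0 * g 0 + 0#) * h (suc n) + (f 0 * ((g ∘ suc) ⋆ h) n + 1# * ((f ∘ suc) ⋆ (g ⋆ h)) n)
      ≈⟨ solve 5 (λ f g h x y → (f :* g :+ con 0) :* h :+ (f :* x :+ con 1 :* y) := f :* (g :* h :+ x) :+ y)
           ≈-refl (f 0) (g 0) (h (suc n)) (((g ∘ suc) ⋆ h) n) (((f ∘ suc) ⋆ (g ⋆ h)) n) ⟩
    f 0 * (g ⋆ h) (suc n) + ((f ∘ suc) ⋆ (g ⋆ h)) n ∎

  -- In terms of series, g = x t h implies f g = x t (f h).
  ⋆-shiftʳ : ∀ n x (f g h : Series) → g 0 ≈ 0# → (∀ i → g (suc i) ≈ x * h i) →
             (f ⋆ g) (suc n) ≈ x * (f ⋆ h) n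
  ⋆-shiftʳ zero x f g h g0 gs = begin
    f 0 * g 1 + (f 1 * g 0 + 0#)   ≈⟨ +-cong (*-congˡ (gs 0)) (+-congʳ (*-congˡ g0)) ⟩
    f 0 * (x * h 0) + (f 1 * 0# + 0#)
      ≈⟨ solve 4 (λ f x h f₁ → f :* (x :* h) :+ (f₁ :* con 0 :+ con 0) := x :* (f :* h :+ con 0)) ≈-refl (f 0) x (h 0) (f 1) ⟩
    x * (f ⋆ h) 0 ∎
  ⋆-shiftʳ (suc n) x f g h g0 gs = begin
    f 0 * g (suc (suc n)) + ((f ∘ suc) ⋆ g) (suc n)
      ≈⟨ +-cong (*-congˡ (gs (suc n))) (⋆-shiftʳ n x (f ∘ suc) g h g0 gs) ⟩
    f 0 * (x * h (suc n)) + x * ((f ∘ suc) ⋆ h) n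
      ≈⟨ solve 4 (λ f x h y → f :* (x :* h) :+ x :* y := x :* (f :* h :+ y)) ≈-refl (f 0) x (h (suc n)) (((f ∘ suc) ⋆ h) n) ⟩
    x * (f ⋆ h) (suc n) ∎

  module _ (γ′ β′ : ℕ → Carrier) where

    J : ℕ → Series
    J k n = Jcoef γ′ β′ n k

    ≤⇒≤ᵇ≡true : ∀ {m n} → m ≤ n → (m ≤ᵇ n) ≡ true
    ≤⇒≤ᵇ≡true p = T⇒≡true (ℕₚ.≤⇒≤ᵇ p)

    -- An entry is computed when the bound of the table first reaches it, and later tables only copy
    -- it.
    tab-stable : ∀ {n m} k → m ≤ n → tab γ′ β′ n m k ≡ J k m
    tab-stable {n} {m} k m≤n with ℕₚ.m≤n⇒m<n∨m≡n m≤n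
    ... | inj₂ refl = refl
    tab-stable {suc n} {m} k m≤n | inj₁ (s≤s m≤n′) rewrite ≤⇒≤ᵇ≡true m≤n′ = tab-stable k m≤n′

    J-step : ∀ k n → J k (suc (suc n)) ≈ γ′ k * J k (suc n) + β′ (suc k) * (J (suc k) ⋆ J k) n
    J-step k n rewrite <ᵇ-irrefl n = +-congˡ (*-congˡ (≈-trans (reflexive (sumL-upTo (suc n) _))
      (Σ#-cong (suc n) λ { a (s≤s a≤n) → *-cong
        (reflexive (tab-stable (suc k) (ℕₚ.m≤n⇒m≤1+n a≤n)))
        (reflexive (tab-stable k (ℕₚ.≤-trans (ℕₚ.m∸n≤m n a) (ℕₚ.n≤1+n n)))) })))

    module _ (down up : ℕ → Carrier) (β≈ : ∀ m → β′ (suc m) ≈ up m * down m) where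

      -- Coefficients of the generating function of paths from level m to
      -- level 0: such a path is an excursion above level m, a step down to
      -- level m − 1, and a path from there.
      descent : ℕ → Series
      descent zero    n       = J 0 n
      descent (suc m) zero    = 0#
      descent (suc m) (suc n) = down m * (J (suc m) ⋆ descent m) n

      descent-step-0 : ∀ n → descent 0 (suc n) ≈ γ′ 0 * descent 0 n + up 0 * descent 1 n
      descent-step-0 zero = solve 2 (λ x y → x :* con 1 := x :* con 1 :+ y :* con 0) ≈-refl (γ′ 0) (up 0)
      descent-step-0 (suc n) = ≈-trans (J-step 0 n)
        (+-congˡ (≈-trans (*-congʳ (β≈ 0)) (*-assoc _ _ _)))

      -- Write F for the series `descent (suc m)` = d t f D, where D is `descent m`. Inserting f = 1
      -- + g t f + u d′ t² f′ f gives d t D + g t F + u t (d′ t f′ F), and the last bracket is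
      -- `descent (suc (suc m))`.
      descent-step : ∀ m n → descent (suc m) (suc n) ≈
        γ′ (suc m) * descent (suc m) n + down m * descent m n + up (suc m) * descent (suc (suc m)) n
      -- The equation `J-step` only covers coefficients from the second on, so that two small cases
      -- are computed directly.
      descent-step m zero =
        solve 4 (λ g d x u → d :* (con 1 :* x :+ con 0) := g :* con 0 :+ d :* x :+ u :* con 0) ≈-refl
          (γ′ (suc m)) (down m) (descent m 0) (up (suc m))
      descent-step m (suc zero) =
        solve 6 (λ g d x y u d′ → d :* (con 1 :* y :+ (g :* con 1 :* x :+ con 0))
                   := g :* (d :* (con 1 :* x :+ con 0)) :+ d :* y :+ u :* (d′ :* (con 1 :* con 0 :+ con 0))) ≈-refl
          (γ′ (suc m)) (down m) (descent m 0) (descent m 1) (up (suc m)) (down (suc m))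
      descent-step m (suc (suc n)) = begin
        d * (1# * Dm (suc (suc n)) + (f 1 * Dm (suc n) + ((f ∘ suc ∘ suc) ⋆ Dm) n))
          ≈⟨ *-congˡ (+-congˡ (+-congˡ (≈-trans (⋆-cong n {g = Dm} (J-step (suc m)) (λ _ → ≈-refl))
               (⋆-linearˡ n g (β′ (suc (suc m))) (f ∘ suc) (f′ ⋆ f) Dm)))) ⟩
        d * (1# * Dm (suc (suc n)) + (g * 1# * Dm (suc n) + (g * ((f ∘ suc) ⋆ Dm) n + β′ (suc (suc m)) * ((f′ ⋆ f) ⋆ Dm) n)))
          ≈⟨ *-congˡ (+-congˡ (+-congˡ (+-congˡ (*-cong (β≈ (suc m)) (⋆-assoc n f′ f Dm))))) ⟩
        d * (1# * Dm (suc (suc n)) + (g * 1# * Dm (suc n) + (g * ((f ∘ suc) ⋆ Dm) n + u * d′ * (f′ ⋆ (f ⋆ Dm)) n)))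
          ≈⟨ solve 8 (λ d X g Y Z u d′ W →
               d :* (con 1 :* X :+ (g :* con 1 :* Y :+ (g :* Z :+ u :* d′ :* W)))
               := g :* (d :* (con 1 :* Y :+ Z)) :+ d :* X :+ u :* (d′ :* (d :* W)))
             ≈-refl d (Dm (suc (suc n))) g (Dm (suc n)) (((f ∘ suc) ⋆ Dm) n) u d′ ((f′ ⋆ (f ⋆ Dm)) n) ⟩
        g * (d * (f ⋆ Dm) (suc n)) + d * Dm (suc (suc n)) + u * (d′ * (d * (f′ ⋆ (f ⋆ Dm)) n))
          ≈⟨ +-congˡ (*-congˡ (*-congˡ (⋆-shiftʳ n d f′ (descent (suc m)) (f ⋆ Dm) ≈-refl (λ _ → ≈-refl)))) ⟨
        g * (d * (f ⋆ Dm) (suc n)) + d * Dm (suc (suc n)) + u * (d′ * (f′ ⋆ descent (suc m)) (suc n)) ∎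
        where
        d = down m
        d′ = down (suc m)
        u = up (suc m)
        g = γ′ (suc m)
        f = J (suc m)
        f′ = J (suc (suc m))
        Dm = descent m

      module _ (S : ℕ → ℕ → Carrier) (S-00 : S 0 0 ≈ 1#) (S-0 : ∀ m → S 0 (suc m) ≈ 0#)
        (S-step-0 : ∀ k → S (suc k) 0 ≈ γ′ 0 * S k 0 + up 0 * S k 1)
        (S-step : ∀ k m → S (suc k) (suc m) ≈
          γ′ (suc m) * S k (suc m) + down m * S k m + up (suc m) * S k (suc (suc m))) where

        S≈descent : ∀ k m → S k m ≈ descent m k
        S≈descent zero zero = S-00
        S≈descent zero (suc m) = S-0 m
        S≈descent (suc k) zero = ≈-trans (S-step-0 k) (≈-trans
          (+-cong (*-congˡ (S≈descent k 0)) (*-congˡ (S≈descent k 1))) (≈-sym (descent-step-0 k)))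
        S≈descent (suc k) (suc m) = ≈-trans (S-step k m) (≈-trans
          (+-cong (+-cong (*-congˡ (S≈descent k (suc m))) (*-congˡ (S≈descent k m))) (*-congˡ (S≈descent k (suc (suc m)))))
          (≈-sym (descent-step m k)))

-- Lookup, positions and counting in words.

at-++ˡ : ∀ pre ys {v} → v < length pre → at (pre ++ ys) (suc v) ≡ at pre (suc v)
at-++ˡ (x ∷ pre) ys {zero} p = refl
at-++ˡ (x ∷ pre) ys {suc v} (s≤s p) = at-++ˡ pre ys p

at-++ʳ : ∀ pre ys t → at (pre ++ ys) (suc (length pre ℕ.+ t)) ≡ at ys (suc t)
at-++ʳ [] ys t = refl
at-++ʳ (x ∷ pre) ys t = at-++ʳ pre ys t

mem-++ : ∀ v pre ys → mem v (pre ++ ys) ≡ mem v pre ∨ mem v ys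
mem-++ v [] ys = refl
mem-++ v (x ∷ pre) ys = trans (cong ((v ≡ᵇ x) ∨_) (mem-++ v pre ys)) (sym (𝔹ₚ.∨-assoc (v ≡ᵇ x) _ _))

∨-false⁻ˡ : ∀ {a b} → a ∨ b ≡ false → a ≡ false
∨-false⁻ˡ {false} _ = refl

∨-false⁻ʳ : ∀ {a b} → a ∨ b ≡ false → b ≡ false
∨-false⁻ʳ {false} e = e

distinct-++ˡ : ∀ pre ys → distinctB (pre ++ ys) ≡ true → distinctB pre ≡ true
distinct-++ˡ [] ys d = refl
distinct-++ˡ (x ∷ pre) ys d = cong₂ _∧_
  (cong not (∨-false⁻ˡ (trans (sym (mem-++ x pre ys)) (not-true⁻ (∧-true⁻ˡ d)))))
  (distinct-++ˡ pre ys (∧-true⁻ʳ {not (mem x (pre ++ ys))} d))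

distinct-++ʳ : ∀ pre ys → distinctB (pre ++ ys) ≡ true → distinctB ys ≡ true
distinct-++ʳ [] ys d = d
distinct-++ʳ (x ∷ pre) ys d = distinct-++ʳ pre ys (∧-true⁻ʳ {not (mem x (pre ++ ys))} d)

distinct-++-disjoint : ∀ pre ys {v} → distinctB (pre ++ ys) ≡ true → mem v pre ≡ true → mem v ys ≡ false
distinct-++-disjoint (x ∷ pre) ys {v} d e with v ≡ᵇ x in v≡x
... | false = distinct-++-disjoint pre ys {v} (∧-true⁻ʳ {not (mem x (pre ++ ys))} d) e
... | true rewrite ≡ᵇ≡true⇒≡ v x v≡x =
  ∨-false⁻ʳ {mem x pre} (trans (sym (mem-++ x pre ys)) (not-true⁻ (∧-true⁻ˡ d)))

mem⇒at : ∀ v xs → mem v xs ≡ true → ∃ λ t → t < length xs × at xs (suc t) ≡ v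
mem⇒at v (x ∷ xs) e with v ≡ᵇ x in v≡x
... | true  = 0 , s≤s z≤n , sym (≡ᵇ≡true⇒≡ v x v≡x)
... | false with mem⇒at v xs e
...   | t , t< , eq = suc t , s≤s t< , eq

at⇒mem : ∀ xs {t} → t < length xs → mem (at xs (suc t)) xs ≡ true
at⇒mem (x ∷ xs) {zero} p rewrite ≡ᵇ-refl x = refl
at⇒mem (x ∷ xs) {suc t} (s≤s p) rewrite at⇒mem xs p = 𝔹ₚ.∨-zeroʳ _

at-injective : ∀ xs {s t} → distinctB xs ≡ true → s < length xs → t < length xs →
               at xs (suc s) ≡ at xs (suc t) → s ≡ t
at-injective (x ∷ xs) {zero} {zero} d p q e = refl
at-injective (x ∷ xs) {zero} {suc t} d p (s≤s q) refl =
  ⊥-elim (true≢false (at⇒mem xs q) (not-true⁻ (∧-true⁻ˡ d)))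
at-injective (x ∷ xs) {suc s} {zero} d (s≤s p) q refl =
  ⊥-elim (true≢false (at⇒mem xs p) (not-true⁻ (∧-true⁻ˡ d)))
at-injective (x ∷ xs) {suc s} {suc t} d (s≤s p) (s≤s q) e =
  cong suc (at-injective xs (∧-true⁻ʳ {not (mem x xs)} d) p q e)

at-inRange : ∀ {n} xs {t} → InRange n xs → t < length xs → 1 ≤ at xs (suc t) × at xs (suc t) ≤ n
at-inRange (x ∷ xs) {zero} (r ∷ _) p = r
at-inRange (x ∷ xs) {suc t} (_ ∷ r) (s≤s p) = at-inRange xs r p

posOf-≥1 : ∀ v xs → mem v xs ≡ true → 1 ≤ posOf v xs
posOf-≥1 v (x ∷ xs) e with x ≡ᵇ v
... | true  = s≤s z≤n
... | false = s≤s z≤n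

posOf-++ˡ : ∀ {v} pre ys → mem v pre ≡ true → posOf v (pre ++ ys) ≤ length pre
posOf-++ˡ {v} (x ∷ pre) ys e rewrite ≡ᵇ-sym v x with x ≡ᵇ v
... | true  = s≤s z≤n
... | false = s≤s (posOf-++ˡ {v} pre ys e)

posOf-++ʳ : ∀ {v} pre ys → mem v pre ≡ false → posOf v (pre ++ ys) ≡ length pre ℕ.+ posOf v ys
posOf-++ʳ [] ys e = refl
posOf-++ʳ {v} (x ∷ pre) ys e rewrite ≡ᵇ-sym v x with x ≡ᵇ v
... | false = cong suc (posOf-++ʳ {v} pre ys e)

count-at : ∀ (P : ℕ → Bool) xs → Σℕ (length xs) (λ t → bit (P (at xs (suc t)))) ≡ count P xs
count-at P [] = refl
count-at P (x ∷ xs) with P x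
... | true  = cong suc (count-at P xs)
... | false = count-at P xs

all-at : ∀ (P : ℕ → Bool) xs → ⋀ (length xs) (λ t → P (at xs (suc t))) ≡ allB P xs
all-at P [] = refl
all-at P (x ∷ xs) = cong (P x ∧_) (all-at P xs)

all≡count : ∀ (P : ℕ → Bool) xs → allB P xs ≡ (count (not ∘ P) xs ≡ᵇ 0)
all≡count P [] = refl
all≡count P (x ∷ xs) with P x
... | true  = all≡count P xs
... | false = refl

Σℕ-≤ : ∀ n (p q : ℕ → Bool) → (∀ v → p v ≡ true → q v ≡ true) → Σℕ n (bit ∘ p) ≤ Σℕ n (bit ∘ q)
Σℕ-≤ zero p q h = z≤n
Σℕ-≤ (suc n) p q h = ℕₚ.+-mono-≤ (head (p 0) (q 0) (h 0)) (Σℕ-≤ n (p ∘ suc) (q ∘ suc) (h ∘ suc))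
  where
  head : ∀ a b → (a ≡ true → b ≡ true) → bit a ≤ bit b
  head false b h = z≤n
  head true b h rewrite h refl = ℕₚ.≤-refl

Σℕ-saturated : ∀ n (p : ℕ → Bool) → n ≤ Σℕ n (bit ∘ p) → ∀ {v} → v < n → p v ≡ true
Σℕ-saturated (suc n) p e {v} v<n with p 0 in p0
... | false = ⊥-elim (ℕₚ.<⇒≱ (s≤s (ℕₚ.≤-trans (Σℕ-≤ n (p ∘ suc) (const true) λ _ _ → refl) (ℕₚ.≤-reflexive (Σℕ-true n)))) e)
Σℕ-saturated (suc n) p e {zero} v<n | true = p0
Σℕ-saturated (suc n) p (s≤s e) {suc v} (s≤s v<n) | true = Σℕ-saturated n (p ∘ suc) e v<n

all⇒count : ∀ (P : ℕ → Bool) xs → allB P xs ≡ true → count P xs ≡ length xs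
all⇒count P [] e = refl
all⇒count P (x ∷ xs) e with P x
... | true = cong suc (all⇒count P xs e)

not-<ᵇ : ∀ {a b} → a ≢ b → not (a <ᵇ b) ≡ (b <ᵇ a)
not-<ᵇ {a} {b} a≢b with ℕₚ.<-cmp a b
... | tri< p _ _ rewrite <⇒<ᵇ≡true p | ≥⇒<ᵇ≡false (ℕₚ.<⇒≤ p) = refl
... | tri≈ _ p _ = ⊥-elim (a≢b p)
... | tri> _ _ p rewrite <⇒<ᵇ≡true p | ≥⇒<ᵇ≡false (ℕₚ.<⇒≤ p) = refl

-- Permutations, their iterates and their cycles.

record IsPerm (n : ℕ) (σ : List ℕ) : Set where
  field
    length≡  : length σ ≡ n
    inRange  : InRange n σ
    distinct : distinctB σ ≡ true

  -- Surjectivity by counting: n distinct letters among 1, ..., n leave none out.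
  occurs : ∀ {v} → v < n → mem (suc v) σ ≡ true
  occurs = Σℕ-saturated n (λ v → mem (suc v) σ)
    (ℕₚ.≤-reflexive (sym (trans (used-total σ distinct inRange) length≡)))

  at-range : ∀ {v} → v < n → ∃ λ u → u < n × at σ (suc v) ≡ suc u
  at-range {v} v<n with at σ (suc v) | at-inRange σ inRange (subst (v <_) (sym length≡) v<n)
  ... | suc u | _ , u<n = u , u<n , refl

  iter-range : ∀ k {v} → v < n → ∃ λ u → u < n × iter σ k (suc v) ≡ suc u
  iter-range zero {v} v<n = v , v<n , refl
  iter-range (suc k) v<n with iter-range k v<n
  ... | u , u<n , e rewrite e = at-range u<n

  iter-injective : ∀ k {u v} → u < n → v < n → iter σ k (suc u) ≡ iter σ k (suc v) → u ≡ v
  iter-injective zero u<n v<n e = ℕₚ.suc-injective e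
  iter-injective (suc k) u<n v<n e with iter-range k u<n | iter-range k v<n
  ... | u′ , u′<n , eu | v′ , v′<n , ev rewrite eu | ev = iter-injective k u<n v<n
    (trans eu (trans (cong suc (at-injective σ distinct (subst (u′ <_) (sym length≡) u′<n) (subst (v′ <_) (sym length≡) v′<n) e)) (sym ev)))

iter-+ : ∀ σ a b v → iter σ (a ℕ.+ b) v ≡ iter σ a (iter σ b v)
iter-+ σ zero b v = refl
iter-+ σ (suc a) b v = cong (at σ) (iter-+ σ a b v)

iter-suc : ∀ σ a v → iter σ (suc a) v ≡ iter σ a (at σ v)
iter-suc σ a v = trans (cong (λ k → iter σ k v) (ℕₚ.+-comm 1 a)) (iter-+ σ a 1 v)

iter-period : ∀ σ r v → iter σ (suc r) v ≡ v → ∀ k → ∃ λ t → t ≤ r × iter σ k v ≡ iter σ t v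
iter-period σ r v e zero = 0 , z≤n , refl
iter-period σ r v e (suc k) with iter-period σ r v e k
... | t , t≤r , eq with ℕₚ.m≤n⇒m<n∨m≡n t≤r
...   | inj₁ t<r  = suc t , t<r , cong (at σ) eq
...   | inj₂ refl = 0 , z≤n , trans (cong (at σ) eq) e

iter-multiple : ∀ σ r v → iter σ r v ≡ v → ∀ c → iter σ (c ℕ.* r) v ≡ v
iter-multiple σ r v e zero = refl
iter-multiple σ r v e (suc c) = trans (iter-+ σ r (c ℕ.* r) v) (trans (cong (iter σ r) (iter-multiple σ r v e c)) e)

-- Ties `pathStart` to the iterates of σ: it is a point from which σ reaches `v` through positions
-- from `i` on only.
pathStart-path : ∀ σ i xs v → (∀ t → t < length xs → at σ (i ℕ.+ t) ≡ at xs (suc t)) →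
  ∃ λ L → iter σ L (pathStart i xs v) ≡ v × (∀ t → t < L → i ≤ iter σ t (pathStart i xs v))
pathStart-path σ i [] v h = 0 , refl , λ _ ()
pathStart-path σ i (x ∷ xs) v h
  with h′ ← (λ t t<k → trans (cong (at σ) (sym (ℕₚ.+-suc i t))) (h (suc t) (s≤s t<k)))
  with pathStart (suc i) xs v ≡ᵇ x in z≡x | pathStart-path σ (suc i) xs v h′ | pathStart-path σ (suc i) xs i h′
... | false | L , e , b | _ = L , e , λ t t<L → ℕₚ.<⇒≤ (b t t<L)
-- The path to `i`, the arc from `i` to `x`, and the former path from `x` to `v` are joined.
... | true  | L , e , b | L′ , e′ , b′ = L ℕ.+ suc L′ , trans (shifted L) e , bound
  where
  y = pathStart (suc i) xs i
  z = pathStart (suc i) xs v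
  arc : iter σ (suc L′) y ≡ z
  arc = trans (cong (at σ) (trans e′ (sym (ℕₚ.+-identityʳ i)))) (trans (h 0 (s≤s z≤n)) (sym (≡ᵇ≡true⇒≡ z x z≡x)))
  shifted : ∀ t → iter σ (t ℕ.+ suc L′) y ≡ iter σ t z
  shifted t = trans (iter-+ σ t (suc L′) y) (cong (iter σ t) arc)
  bound : ∀ t → t < L ℕ.+ suc L′ → i ≤ iter σ t y
  bound t t< with ℕₚ.<-cmp t L′
  ... | tri< t<L′ _ _ = ℕₚ.<⇒≤ (b′ t t<L′)
  ... | tri≈ _ refl _ = ℕₚ.≤-reflexive (sym e′)
  ... | tri> _ _ L′<t with ℕₚ.m≤n⇒∃[o]m+o≡n L′<t
  ...   | o , eq = subst (λ t → i ≤ iter σ t y) (sym eq′)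
    (subst (i ≤_) (sym (shifted o)) (ℕₚ.<⇒≤ (b o (ℕₚ.+-cancelʳ-< (suc L′) o L (subst (_< L ℕ.+ suc L′) eq′ t<)))))
    where
    eq′ : t ≡ o ℕ.+ suc L′
    eq′ = trans (sym eq) (ℕₚ.+-comm (suc L′) o)

allB-upTo : ∀ P n → allB P (upTo n) ≡ ⋀ n P
allB-upTo P n = foldr-upTo n id P
  where open BigOp 𝔹ₚ.∧-commutativeMonoid using (foldr-upTo)

module _ {n σ} (perm : IsPerm n σ) where
  open IsPerm perm

  -- Two of the n + 1 iterates with exponents 0, ..., n agree, and injectivity cancels the smaller
  -- exponent. The bound by n matters because `isCycMin` tests only the exponents below n.
  returns : ∀ {v} → v < n → ∃ λ r → suc r ≤ n × iter σ (suc r) (suc v) ≡ suc v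
  returns {v} v<n
    with Finₚ.pigeonhole (ℕₚ.n<1+n n) (λ j → fromℕ< (proj₁ (proj₂ (iter-range (toℕ j) v<n))))
  ... | a , b , a<b , e with ℕₚ.m≤n⇒∃[o]m+o≡n a<b | iter-range (toℕ a) v<n | iter-range (toℕ b) v<n | Finₚ.fromℕ<-injective _ _ _ _ e
  ... | o , eq | u , _ , ea | .u , _ , eb | refl with iter-range (suc o) v<n
  ... | v′ , v′<n , ev = o , bound , trans ev (cong suc (sym v≡v′))
    where
    b≡ : toℕ b ≡ toℕ a ℕ.+ suc o
    b≡ = trans (sym eq) (sym (ℕₚ.+-suc (toℕ a) o))
    bound : suc o ≤ n
    bound = ℕₚ.≤-trans (ℕₚ.m≤n+m (suc o) (toℕ a)) (subst (_≤ n) b≡ (ℕₚ.≤-pred (Finₚ.toℕ<n b)))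
    v≡v′ : v ≡ v′
    v≡v′ = iter-injective (toℕ a) v<n v′<n (trans ea (trans (sym eb) (trans
      (trans (cong (λ k → iter σ k (suc v)) b≡) (iter-+ σ (toℕ a) (suc o) (suc v))) (cong (iter σ (toℕ a)) ev))))

  isCycMin-true⁻ : ∀ {i} → i < n → isCycMin σ (suc i) ≡ true → ∀ k → suc i ≤ iter σ k (suc i)
  isCycMin-true⁻ {i} i<n e k with returns i<n
  ... | r , r<n , back with iter-period σ r (suc i) back k
  ...   | t , t≤r , eq rewrite eq | length≡ = ℕₚ.≤ᵇ⇒≤ (suc i) (iter σ t (suc i)) (≡true⇒T
    (⋀-true⁻ (trans (sym (allB-upTo _ n)) e) (ℕₚ.≤-<-trans t≤r r<n)))

  isCycMin-true⁺ : ∀ {i} → (∀ k → i ≤ iter σ k i) → isCycMin σ i ≡ true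
  isCycMin-true⁺ h = trans (allB-upTo _ (length σ)) (⋀-true⁺ (length σ) λ k _ → T⇒≡true (ℕₚ.≤⇒≤ᵇ (h k)))

  same-cycle : ∀ {q i} L → q < n → i < n → iter σ L (suc q) ≡ suc i → ∃ λ k → iter σ k (suc i) ≡ suc q
  same-cycle {q} {i} L q<n i<n e with returns i<n
  ... | r , _ , back with iter-range (L ℕ.* r) i<n
  -- The period is `suc r`, so L * r steps lead back: L more make L * suc r, a multiple of the
  -- period, and injectivity of L steps identifies the point reached.
  ...   | u , u<n , eu = L ℕ.* r , trans eu (cong suc (iter-injective L u<n q<n (begin
    iter σ L (suc u)                       ≡⟨ cong (iter σ L) (sym eu) ⟩
    iter σ L (iter σ (L ℕ.* r) (suc i))    ≡⟨ sym (iter-+ σ L (L ℕ.* r) (suc i)) ⟩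
    iter σ (L ℕ.+ L ℕ.* r) (suc i)         ≡⟨ cong (λ k → iter σ k (suc i)) (sym (ℕₚ.*-suc L r)) ⟩
    iter σ (L ℕ.* suc r) (suc i)           ≡⟨ iter-multiple σ (suc r) (suc i) back L ⟩
    suc i                                  ≡⟨ sym e ⟩
    iter σ L (suc q) ∎)))
    where open ≡-Reasoning

-- The statistics at one position, read off from its letter and tail.

module Factor {n pre x xs} (perm : IsPerm n (pre ++ x ∷ xs)) where
  open IsPerm perm public
  σ = pre ++ x ∷ xs
  m = length pre
  i = suc m
  k = length xs

  length-σ : i ℕ.+ k ≡ n
  length-σ = trans (sym (ℕₚ.+-suc m k)) (trans (sym (Lₚ.length-++ pre)) length≡)

  m<n : m < n
  m<n = subst (m <_) length-σ (s≤s (ℕₚ.m≤m+n m k))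

  at-i : at σ i ≡ x
  at-i = trans (cong (at σ ∘ suc) (sym (ℕₚ.+-identityʳ m))) (at-++ʳ pre (x ∷ xs) 0)

  at-tail : ∀ t → at σ (suc i ℕ.+ t) ≡ at xs (suc t)
  at-tail t = trans (cong (at σ ∘ suc) (sym (ℕₚ.+-suc m t))) (at-++ʳ pre (x ∷ xs) (suc t))

  distinct-tail : distinctB (x ∷ xs) ≡ true
  distinct-tail = distinct-++ʳ pre (x ∷ xs) distinct

  private
    Z = pathStart (suc i) xs i
    path-to-i : ∃ λ L → iter σ L Z ≡ i × (∀ t → t < L → suc i ≤ iter σ t Z)
    path-to-i = pathStart-path σ (suc i) xs i λ t _ → at-tail t
    L = proj₁ path-to-i
    path : iter σ L Z ≡ i
    path = proj₁ (proj₂ path-to-i)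

  -- The cycle then consists of the path from `Z` to `i`, whose vertices before `i` are larger than
  -- `i`.
  closed-isCycMin : x ≡ Z → isCycMin σ i ≡ true
  closed-isCycMin x≡Z = isCycMin-true⁺ perm λ
    { zero → ℕₚ.≤-refl
    ; (suc j) → subst (i ≤_) (sym (trans (iter-suc σ j i) (cong (iter σ j) (trans at-i x≡Z)))) (stays j) }
    where
    closed : iter σ (suc L) Z ≡ Z
    closed = trans (cong (at σ) path) (trans at-i x≡Z)
    stays : ∀ j → i ≤ iter σ j Z
    stays j with iter-period σ L Z closed j
    ... | t , t≤L , eq with ℕₚ.m≤n⇒m<n∨m≡n t≤L
    ...   | inj₁ t<L  = subst (i ≤_) (sym eq) (ℕₚ.<⇒≤ (proj₂ (proj₂ path-to-i) t t<L))
    ...   | inj₂ t≡L = ℕₚ.≤-reflexive (sym (trans eq (trans (cong (λ u → iter σ u Z) t≡L) path)))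

  private
    Z≤n : Z ≤ n
    Z≤n = subst (Z ≤_) length-σ (ℕₚ.≤-pred (pathStart-≤ (suc i) xs {i} (s≤s (ℕₚ.m≤m+n i k))))

    Z≥1 : 1 ≤ Z
    Z≥1 with mem i xs in ei
    ... | true  = ℕₚ.≤-trans (s≤s z≤n) (pathStart-of-used (suc i) xs {i} (∧-true⁻ʳ {not (mem x xs)} distinct-tail) ei)
    ... | false = subst (1 ≤_) (sym (pathStart-of-unused (suc i) xs {i} ei)) (s≤s z≤n)

    occurs′ : ∀ z → 1 ≤ z → z ≤ n → mem z σ ≡ true
    occurs′ (suc z) _ z<n = occurs z<n

  unused⇒before : ∀ v → mem v σ ≡ true → mem v (x ∷ xs) ≡ false → mem v pre ≡ true
  unused⇒before v e e′ = trans (sym (𝔹ₚ.∨-identityʳ (mem v pre)))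
    (trans (cong (mem v pre ∨_) (sym e′)) (trans (sym (mem-++ v pre (x ∷ xs))) e))

  -- Unless x = Z, the letter Z occurs before position i, so that the
  -- cycle of i enters the path from Z at a smaller position.
  open-not-isCycMin : (x ≡ᵇ Z) ≡ false → isCycMin σ i ≡ true → ⊥
  open-not-isCycMin x≢Z c = ℕₚ.<⇒≱ q<m (ℕₚ.≤-pred (subst (i ≤_) (proj₂ visit) (isCycMin-true⁻ perm m<n c (proj₁ visit))))
    where
    Z-before : ∃ λ q → q < m × at pre (suc q) ≡ Z
    Z-before = mem⇒at Z pre (unused⇒before Z (occurs′ Z Z≥1 Z≤n)
      (cong₂ _∨_ (trans (≡ᵇ-sym Z x) x≢Z) (pathStart-unused (suc i) xs {i} ℕₚ.≤-refl)))
    q = proj₁ Z-before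
    q<m : q < m
    q<m = proj₁ (proj₂ Z-before)
    visit : ∃ λ j → iter σ j i ≡ suc q
    visit = same-cycle perm (suc L) (ℕₚ.<-trans q<m m<n) m<n (trans (iter-suc σ L (suc q))
      (trans (cong (iter σ L) (trans (at-++ˡ pre (x ∷ xs) q<m) (proj₂ (proj₂ Z-before)))) path))

  isCycMin≡ : isCycMin σ i ≡ (x ≡ᵇ pathStart (suc i) xs i)
  isCycMin≡ = decide (isCycMin σ i) (x ≡ᵇ Z) (λ e → closed-isCycMin (≡ᵇ≡true⇒≡ x Z e)) open-not-isCycMin
    where
    decide : ∀ a b → (b ≡ true → a ≡ true) → (b ≡ false → a ≡ true → ⊥) → a ≡ b
    decide true  true  p q = refl
    decide true  false p q = ⊥-elim (q refl refl)
    decide false true  p q = p refl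
    decide false false p q = refl

  x∉xs : mem x xs ≡ false
  x∉xs = not-true⁻ (∧-true⁻ˡ distinct-tail)

  distinct-xs : distinctB xs ≡ true
  distinct-xs = ∧-true⁻ʳ {not (mem x xs)} distinct-tail

  inRange-tail : InRange n (x ∷ xs)
  inRange-tail = Allₚ.++⁻ʳ pre inRange

  x-inRange : 1 ≤ x × x ≤ n
  x-inRange = All.head inRange-tail

  after-not-before : ∀ v → mem v (x ∷ xs) ≡ true → mem v pre ≡ false
  after-not-before v e with mem v pre in e′
  ... | false = refl
  ... | true  = ⊥-elim (true≢false e (distinct-++-disjoint pre (x ∷ xs) {v} distinct e′))

  before≡ : ∀ {v} → v < n → mem (suc v) pre ≡ not (mem (suc v) (x ∷ xs))
  before≡ {v} v<n = decide (mem (suc v) (x ∷ xs)) (after-not-before (suc v)) (unused⇒before (suc v) (occurs v<n))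
    where
    decide : ∀ b {a} → (b ≡ true → a ≡ false) → (b ≡ false → a ≡ true) → a ≡ not b
    decide true  p q = p refl
    decide false p q = q refl

  hit-not-before : x ≢ i → mem i pre ≡ not (mem i xs)
  hit-not-before x≢i = trans (before≡ m<n) (cong (λ b → not (b ∨ mem i xs)) (≢⇒≡ᵇ≡false {i} {x} (x≢i ∘ sym)))

  posOf-< : (posOf i σ <ᵇ i) ≡ mem i pre
  posOf-< with mem i pre in e
  ... | true  = <⇒<ᵇ≡true (s≤s (posOf-++ˡ {i} pre (x ∷ xs) e))
  ... | false rewrite posOf-++ʳ {i} pre (x ∷ xs) e =
    ≥⇒<ᵇ≡false (ℕₚ.≤-trans (ℕₚ.≤-reflexive (ℕₚ.+-comm 1 m)) (ℕₚ.+-monoʳ-≤ m (posOf-≥1 i (x ∷ xs) here)))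
    where
    here : mem i (x ∷ xs) ≡ true
    here = trans (sym (cong (_∨ mem i (x ∷ xs)) e)) (trans (sym (mem-++ i pre (x ∷ xs))) (occurs m<n))

  posOf-> : x ≢ i → (i <ᵇ posOf i σ) ≡ mem i xs
  posOf-> x≢i with mem i pre in e | hit-not-before x≢i
  ... | true  | h = trans (≥⇒<ᵇ≡false (ℕₚ.m≤n⇒m≤1+n (posOf-++ˡ {i} pre (x ∷ xs) e))) (sym (not-true⁻ (sym h)))
  ... | false | h rewrite posOf-++ʳ {i} pre (x ∷ xs) e | ≢⇒≡ᵇ≡false x≢i =
    trans (<⇒<ᵇ≡true (ℕₚ.≤-trans (s≤s (ℕₚ.≤-reflexive (ℕₚ.+-comm 1 m)))
            (ℕₚ.≤-trans (ℕₚ.≤-reflexive (sym (ℕₚ.+-suc m 1))) (ℕₚ.+-monoʳ-≤ m (s≤s (posOf-≥1 i xs hit)))))) (sym hit)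
    where
    hit : mem i xs ≡ true
    hit = trans (sym (𝔹ₚ.not-involutive (mem i xs))) (cong not (sym h))

  count-before : ∀ (P : ℕ → Bool) → count (λ j → P (at σ j)) (range m) ≡ count P pre
  count-before P = trans (count-range _ m) (trans
    (Σℕ-cong m λ v v<m → cong (bit ∘ P) (at-++ˡ pre (x ∷ xs) v<m)) (count-at P pre))

  all-before : ∀ (P : ℕ → Bool) → allB (λ j → P (at σ j)) (range m) ≡ allB P pre
  all-before P = trans (⋀-range m _) (trans
    (⋀-cong m λ v v<m → cong P (at-++ˡ pre (x ∷ xs) v<m)) (all-at P pre))

  private
    n≡ : length σ ≡ i ℕ.+ k
    n≡ = trans length≡ (sym length-σ)

  count-after : ∀ (P : ℕ → Bool) → count (λ l → (i <ᵇ l) ∧ P (at σ l)) (range (length σ)) ≡ count P xs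
  count-after P = trans (count-range _ (length σ)) (trans (cong (λ N → countTo N p) n≡) (trans (Σℕ-++ i k (bit ∘ p ∘ suc))
    (cong₂ ℕ._+_
      (trans (Σℕ-cong i λ v v<i → cong bit (∧-falseˡ {b = P (at σ (suc v))} (≥⇒<ᵇ≡false v<i))) (Σℕ-0 i))
      (trans (Σℕ-cong k λ t _ → cong bit (cong₂ _∧_ (<ᵇ-suc-+ i t) (cong P (at-tail t)))) (count-at P xs)))))
    where
    p : ℕ → Bool
    p l = (i <ᵇ l) ∧ P (at σ l)

  all-after : ∀ (P : ℕ → Bool) →
    allB (λ j → if i <ᵇ j then P (at σ j) else true) (range (length σ)) ≡ allB P xs
  all-after P = trans (⋀-range (length σ) p) (trans (cong (λ N → ⋀ N (p ∘ suc)) n≡) (trans (⋀-++ i k (p ∘ suc))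
    (cong₂ _∧_
      (⋀-true⁺ i λ v v<i → cong (λ b → if b then P (at σ (suc v)) else true) (≥⇒<ᵇ≡false v<i))
      (trans (⋀-cong k λ t _ → trans (cong (λ b → if b then P (at σ (suc (i ℕ.+ t))) else true) (<ᵇ-suc-+ i t))
                                     (cong P (at-tail t))) (all-at P xs)))))
    where
    p : ℕ → Bool
    p j = if i <ᵇ j then P (at σ j) else true

  -- The letters before position `i` are the complement of the rest, so that a count over earlier
  -- positions becomes one that mentions the tail only.
  values-before : ∀ (P : ℕ → Bool) → count P pre ≡ countTo (i ℕ.+ k) (λ v → not (mem v (x ∷ xs)) ∧ P v)
  values-before P = trans (sym (countTo-used pre P (distinct-++ˡ pre (x ∷ xs) distinct) (Allₚ.++⁻ˡ pre inRange)))
    (trans (Σℕ-cong n λ v v<n → cong (λ b → bit (b ∧ P (suc v))) (before≡ v<n))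
           (cong (λ N → countTo N (λ v → not (mem v (x ∷ xs)) ∧ P v)) (sym length-σ)))

  values-after : ∀ (P : ℕ → Bool) → count P xs ≡ countTo (i ℕ.+ k) (λ v → mem v xs ∧ P v)
  values-after P = trans (sym (countTo-used xs P distinct-xs (All.tail inRange-tail)))
    (cong (λ N → countTo N (λ v → mem v xs ∧ P v)) (sym length-σ))

  -- Since `Q` fails at `x`, it need not be excluded separately, and the count takes the form of the
  -- tail statistics.
  values-before′ : ∀ (P Q : ℕ → Bool) → (∀ v → v ≢ x → P v ≡ Q v) → Q x ≡ false →
    count P pre ≡ countTo (i ℕ.+ k) (λ v → not (mem v xs) ∧ Q v)
  values-before′ P Q h q = trans (values-before P) (Σℕ-cong (i ℕ.+ k) λ v _ → cong bit (drop-x (suc v)))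
    where
    drop-x : ∀ v → not (mem v (x ∷ xs)) ∧ P v ≡ not (mem v xs) ∧ Q v
    drop-x v with v ≡ᵇ x in e
    ... | false = cong (not (mem v xs) ∧_) (h v (≡ᵇ≡false⇒≢ v x e))
    ... | true rewrite ≡ᵇ≡true⇒≡ v x e | q = sym (𝔹ₚ.∧-zeroʳ _)

  values-after′ : ∀ (P Q : ℕ → Bool) → (∀ v → v ≢ x → P v ≡ Q v) →
    count P xs ≡ countTo (i ℕ.+ k) (λ v → mem v xs ∧ Q v)
  values-after′ P Q h = trans (values-after P) (Σℕ-cong (i ℕ.+ k) λ v _ → cong bit (not-x (suc v)))
    where
    not-x : ∀ v → mem v xs ∧ P v ≡ mem v xs ∧ Q v
    not-x v with mem v xs in e
    ... | false = refl
    ... | true  = h v λ { refl → true≢false e x∉xs }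

  psnestAt≡ : x ≤ i → psnestAt σ i ≡ gaps i xs
  psnestAt≡ x≤i = trans (count-before (i <ᵇ_)) (values-before′ (i <ᵇ_) (i <ᵇ_) (λ _ _ → refl) (≥⇒<ᵇ≡false x≤i))

  lcross≡ : x < i → lcross σ i ≡ lcrossTail i x xs
  lcross≡ x<i = trans (cong (λ y → count (λ l → (i <ᵇ l) ∧ (y <ᵇ at σ l) ∧ (at σ l <ᵇ i)) (range (length σ))) at-i)
    (trans (count-after P) (values-after P))
    where
    P : ℕ → Bool
    P v = (x <ᵇ v) ∧ (v <ᵇ i)

  lnest≡ : x < i → lnest σ i ≡ lnestTail i x xs
  lnest≡ x<i = trans (cong (λ y → count (λ l → (i <ᵇ l) ∧ (at σ l <ᵇ y) ∧ (y <ᵇ i)) (range (length σ))) at-i)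
    (trans (count-after P) (values-after′ P (_<ᵇ x) λ v _ → trans (cong ((v <ᵇ x) ∧_) (<⇒<ᵇ≡true x<i)) (𝔹ₚ.∧-identityʳ (v <ᵇ x))))
    where
    P : ℕ → Bool
    P v = (v <ᵇ x) ∧ (x <ᵇ i)

  ucross≡ : i < x → ucross σ i ≡ ucrossTail i x xs
  ucross≡ i<x = trans (cong (λ y → count (λ j → (i <ᵇ at σ j) ∧ (at σ j <ᵇ y)) (range m)) at-i)
    (trans (count-before P) (values-before′ P P (λ _ _ → refl) (∧-falseʳ (<ᵇ-irrefl x))))
    where
    P : ℕ → Bool
    P v = (i <ᵇ v) ∧ (v <ᵇ x)

  private
    above-x : i < x → ∀ v → (x <ᵇ v) ≡ (i <ᵇ v) ∧ (x <ᵇ v)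
    above-x i<x v with x <ᵇ v in e
    ... | false = sym (𝔹ₚ.∧-zeroʳ _)
    ... | true  rewrite <⇒<ᵇ≡true (ℕₚ.<-trans i<x (<ᵇ≡true⇒< x v e)) = refl

  unest≡ : i < x → unest σ i ≡ unestTail i x xs
  unest≡ i<x = trans (cong (λ y → count (λ j → (i <ᵇ y) ∧ (y <ᵇ at σ j)) (range m)) at-i)
    (trans (count-before P) (values-before′ P Q
      (λ v _ → trans (cong (_∧ (x <ᵇ v)) (<⇒<ᵇ≡true i<x)) (above-x i<x v)) (∧-falseʳ (<ᵇ-irrefl x))))
    where
    P Q : ℕ → Bool
    P v = (i <ᵇ x) ∧ (x <ᵇ v)
    Q v = (i <ᵇ v) ∧ (x <ᵇ v)

  isRec≡ : isRec σ i ≡ allB (_<ᵇ x) pre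
  isRec≡ = trans (cong (λ y → allB (λ j → at σ j <ᵇ y) (range m)) at-i) (all-before (_<ᵇ x))

  isARec≡ : isARec σ i ≡ allB (x <ᵇ_) xs
  isARec≡ = trans (cong (λ y → allB (λ j → if i <ᵇ j then y <ᵇ at σ j else true) (range (length σ))) at-i) (all-after (x <ᵇ_))

  -- An earlier letter exceeding `x` is exactly a nesting above the arc from `i`. With
  -- `isARec-upper` this makes the record exclusive, so that the nesting number decides between the
  -- variables y and v.
  isRec-upper : i < x → isRec σ i ≡ (unestTail i x xs ≡ᵇ 0)
  isRec-upper i<x = trans isRec≡ (trans (all≡count (_<ᵇ x) pre) (cong (_≡ᵇ 0)
    (values-before′ (λ v → not (v <ᵇ x)) (λ v → (i <ᵇ v) ∧ (x <ᵇ v))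
      (λ v v≢x → trans (not-<ᵇ v≢x) (above-x i<x v)) (∧-falseʳ (<ᵇ-irrefl x)))))

  isARec-lower : isARec σ i ≡ (lnestTail i x xs ≡ᵇ 0)
  isARec-lower = trans isARec≡ (trans (all≡count (x <ᵇ_) xs) (cong (_≡ᵇ 0)
    (values-after′ (λ v → not (x <ᵇ v)) (_<ᵇ x) (λ v v≢x → not-<ᵇ (v≢x ∘ sym)))))

  -- Otherwise the i − 1 letters before position i would all be less than x.
  isRec-lower : x < i → isRec σ i ≡ false
  isRec-lower x<i with isRec σ i in e
  ... | false = refl
  ... | true  = ⊥-elim (absurd x x<i x-inRange (trans (sym isRec≡) e))
    where
    absurd : ∀ y → y < i → 1 ≤ y × y ≤ n → allB (_<ᵇ y) pre ≡ true → ⊥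
    absurd (suc y) (s≤s y<m) (_ , y<n) a = ℕₚ.<⇒≱ y<m (subst₂ _≤_
      (trans (countTo-used pre (_<ᵇ suc y) (distinct-++ˡ pre (x ∷ xs) distinct) (Allₚ.++⁻ˡ pre inRange)) (all⇒count (_<ᵇ suc y) pre a))
      (Σℕ-below (ℕₚ.<⇒≤ y<n))
      (Σℕ-≤ n (λ v → mem (suc v) pre ∧ (v <ᵇ y)) (_<ᵇ y) λ v → ∧-true⁻ʳ {mem (suc v) pre}))

  -- Otherwise the letters from position i on, which are n − i + 1 in number,
  -- would all exceed i.
  isARec-upper : i < x → isARec σ i ≡ false
  isARec-upper i<x with isARec σ i in e
  ... | false = refl
  ... | true  = ⊥-elim (ℕₚ.<-irrefl refl (subst₂ _≤_
    (trans (countTo-used (x ∷ xs) (i <ᵇ_) distinct-tail inRange-tail) (all⇒count (i <ᵇ_) (x ∷ xs)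
      (cong₂ _∧_ (<⇒<ᵇ≡true i<x) (exceed xs (trans (sym isARec≡) e)))))
    (trans (cong (λ N → countTo N (i <ᵇ_)) (sym length-σ)) (trans (Σℕ-++ i k (λ v → bit (i <ᵇ suc v))) (cong₂ ℕ._+_
      (trans (Σℕ-cong i λ v v<i → cong bit (≥⇒<ᵇ≡false v<i)) (Σℕ-0 i))
      (trans (Σℕ-cong k λ t _ → cong bit (<ᵇ-suc-+ i t)) (Σℕ-true k)))))
    (Σℕ-≤ n (λ v → mem (suc v) (x ∷ xs) ∧ (i <ᵇ suc v)) (λ v → i <ᵇ suc v) λ v → ∧-true⁻ʳ {mem (suc v) (x ∷ xs)})))
    where
    exceed : ∀ ys → allB (x <ᵇ_) ys ≡ true → allB (i <ᵇ_) ys ≡ true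
    exceed [] a = refl
    exceed (y ∷ ys) a = cong₂ _∧_ (<⇒<ᵇ≡true (ℕₚ.<-trans i<x (<ᵇ≡true⇒< x y (∧-true⁻ˡ a))))
                                  (exceed ys (∧-true⁻ʳ {x <ᵇ y} a))

-- The weight as a product over positions, and the sum over permutations as a sum over words.

module Factorisation {c ℓ : Level} (R : CommutativeRing c ℓ) (V : RingDefs.Vars R) where
  open CommutativeRing R
    using (Carrier; _≈_; _+_; _*_; 0#; 1#; setoid; *-commutativeMonoid; commutativeSemiring; +-congˡ;
      *-cong; *-congˡ; +-identityˡ; +-identityʳ; *-identityˡ; *-identityʳ; +-assoc; +-comm; reflexive)
    renaming (refl to ≈-refl; sym to ≈-sym; trans to ≈-trans)
  open RingDefs R
  open Vars V
  open Words R
  open Scan R V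
  open import Relation.Binary.Reasoning.Setoid setoid
  open import Algebra.Solver.Ring.NaturalCoefficients.Default commutativeSemiring
    using (solve; _:*_; _:=_; con)
  open BigOp *-commutativeMonoid using () renaming
    ( ⨁ to Π#; ⨁-cong to Π#-cong; ⨁-∙ to Π#-*; foldr-range to Π#-range)

  -- The Booleans tell whether σ⁻¹(i) < i, i < σ⁻¹(i), σ(i) < i, i < σ(i),
  -- σ(i) = i, and whether i is a record, an antirecord, a least element of
  -- a cycle.
  factor : (lt gt l u f r a c : Bool) (lc ln uc un g : ℕ) → Carrier
  factor lt gt l u f r a c lc ln uc un g =
    (if (lt ∧ l) ∧ (a ∧ not r) then x₁ else 1#) *
    (if (gt ∧ l) ∧ (a ∧ not r) then x₂ else 1#) *
    (if (gt ∧ u) ∧ (r ∧ not a) then y₁ else 1#) *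
    (if (lt ∧ u) ∧ (r ∧ not a) then y₂ else 1#) *
    (if (lt ∧ l) ∧ (not r ∧ not a) then u₁ else 1#) *
    (if (gt ∧ l) ∧ (not r ∧ not a) then u₂ else 1#) *
    (if (gt ∧ u) ∧ (not r ∧ not a) then v₁ else 1#) *
    (if (lt ∧ u) ∧ (not r ∧ not a) then v₂ else 1#) *
    (if f then w g else 1#) *
    (if gt ∧ u then pow p₊₁ uc else 1#) *
    (if lt ∧ u then pow p₊₂ uc else 1#) *
    (if lt ∧ l then pow p₋₁ lc else 1#) *
    (if gt ∧ l then pow p₋₂ lc else 1#) *
    (if gt ∧ u then pow q₊₁ un else 1#) *
    (if lt ∧ u then pow q₊₂ un else 1#) *
    (if lt ∧ l then pow q₋₁ ln else 1#) *
    (if gt ∧ l then pow q₋₂ ln else 1#) *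
    (if f then pow s g else 1#) *
    (if c then lam else 1#)

  factor-fix : ∀ r a lc ln uc un g c →
    factor false false false false true r a c lc ln uc un g ≈ w g * pow s g * (if c then lam else 1#)
  factor-fix r a lc ln uc un g c = solve 3 (λ W S L → let o = con 1 in
      o :* o :* o :* o :* o :* o :* o :* o :* W :* o :* o :* o :* o :* o :* o :* o :* o :* S :* L := W :* S :* L)
      ≈-refl (w g) (pow s g) (if c then lam else 1#)

  factor-lower : ∀ h a lc ln uc un g c →
    factor (not h) h true false false false a c lc ln uc un g
    ≈ (if h then pow p₋₂ lc * pow q₋₂ ln * (if a then x₂ else u₂) else pow p₋₁ lc * pow q₋₁ ln * (if a then x₁ else u₁))
      * (if c then lam else 1#)
  factor-lower true true lc ln uc un g c = solve 4 (λ P Q X L → let o = con 1 in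
      o :* X :* o :* o :* o :* o :* o :* o :* o :* o :* o :* o :* P :* o :* o :* o :* Q :* o :* L := P :* Q :* X :* L)
      ≈-refl (pow p₋₂ lc) (pow q₋₂ ln) x₂ (if c then lam else 1#)
  factor-lower true false lc ln uc un g c = solve 4 (λ P Q X L → let o = con 1 in
      o :* o :* o :* o :* o :* X :* o :* o :* o :* o :* o :* o :* P :* o :* o :* o :* Q :* o :* L := P :* Q :* X :* L)
      ≈-refl (pow p₋₂ lc) (pow q₋₂ ln) u₂ (if c then lam else 1#)
  factor-lower false true lc ln uc un g c = solve 4 (λ P Q X L → let o = con 1 in
      X :* o :* o :* o :* o :* o :* o :* o :* o :* o :* o :* P :* o :* o :* o :* Q :* o :* o :* L := P :* Q :* X :* L)
      ≈-refl (pow p₋₁ lc) (pow q₋₁ ln) x₁ (if c then lam else 1#)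
  factor-lower false false lc ln uc un g c = solve 4 (λ P Q X L → let o = con 1 in
      o :* o :* o :* o :* X :* o :* o :* o :* o :* o :* o :* P :* o :* o :* o :* Q :* o :* o :* L := P :* Q :* X :* L)
      ≈-refl (pow p₋₁ lc) (pow q₋₁ ln) u₁ (if c then lam else 1#)

  factor-upper : ∀ h r lc ln uc un g c →
    factor (not h) h false true false r false c lc ln uc un g
    ≈ (if h then pow p₊₁ uc * pow q₊₁ un * (if r then y₁ else v₁) else pow p₊₂ uc * pow q₊₂ un * (if r then y₂ else v₂))
      * (if c then lam else 1#)
  factor-upper true true lc ln uc un g c = solve 4 (λ P Q X L → let o = con 1 in
      o :* o :* X :* o :* o :* o :* o :* o :* o :* P :* o :* o :* o :* Q :* o :* o :* o :* o :* L := P :* Q :* X :* L)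
      ≈-refl (pow p₊₁ uc) (pow q₊₁ un) y₁ (if c then lam else 1#)
  factor-upper true false lc ln uc un g c = solve 4 (λ P Q X L → let o = con 1 in
      o :* o :* o :* o :* o :* o :* X :* o :* o :* P :* o :* o :* o :* Q :* o :* o :* o :* o :* L := P :* Q :* X :* L)
      ≈-refl (pow p₊₁ uc) (pow q₊₁ un) v₁ (if c then lam else 1#)
  factor-upper false true lc ln uc un g c = solve 4 (λ P Q X L → let o = con 1 in
      o :* o :* o :* X :* o :* o :* o :* o :* o :* o :* P :* o :* o :* o :* Q :* o :* o :* o :* L := P :* Q :* X :* L)
      ≈-refl (pow p₊₂ uc) (pow q₊₂ un) y₂ (if c then lam else 1#)
  factor-upper false false lc ln uc un g c = solve 4 (λ P Q X L → let o = con 1 in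
      o :* o :* o :* o :* o :* o :* o :* X :* o :* o :* P :* o :* o :* o :* Q :* o :* o :* o :* L := P :* Q :* X :* L)
      ≈-refl (pow p₊₂ uc) (pow q₊₂ un) v₂ (if c then lam else 1#)

  factor-≡ : ∀ {lt lt′ gt gt′ l l′ u u′ f f′ r r′ a a′ c c′ lc lc′ ln ln′ uc uc′ un un′ g g′} →
    lt ≡ lt′ → gt ≡ gt′ → l ≡ l′ → u ≡ u′ → f ≡ f′ → r ≡ r′ → a ≡ a′ → c ≡ c′ →
    lc ≡ lc′ → ln ≡ ln′ → uc ≡ uc′ → un ≡ un′ → g ≡ g′ →
    factor lt gt l u f r a c lc ln uc un g ≡ factor lt′ gt′ l′ u′ f′ r′ a′ c′ lc′ ln′ uc′ un′ g′
  factor-≡ refl refl refl refl refl refl refl refl refl refl refl refl refl = refl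

  vertexFactor : List ℕ → ℕ → Carrier
  vertexFactor σ i = factor (posOf i σ <ᵇ i) (i <ᵇ posOf i σ) (at σ i <ᵇ i) (i <ᵇ at σ i) (isFix σ i)
    (isRec σ i) (isARec σ i) (isCycMin σ i) (lcross σ i) (lnest σ i) (ucross σ i) (unest σ i) (psnestAt σ i)

  vertexFactor≈headWeight : ∀ {n} pre x xs → IsPerm n (pre ++ x ∷ xs) →
    vertexFactor (pre ++ x ∷ xs) (suc (length pre)) ≈ headWeight (suc (length pre)) x xs
  vertexFactor≈headWeight pre x xs perm with ℕₚ.<-cmp x (suc (length pre))
  ... | tri< x<i x≢i _ = begin
    vertexFactor σ i
      ≡⟨ factor-≡ (trans posOf-< (hit-not-before x≢i)) (posOf-> x≢i)
           (trans (cong (_<ᵇ i) at-i) (<⇒<ᵇ≡true x<i)) (trans (cong (i <ᵇ_) at-i) (≥⇒<ᵇ≡false (ℕₚ.<⇒≤ x<i)))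
           (trans (cong (_≡ᵇ i) at-i) (≢⇒≡ᵇ≡false x≢i)) (isRec-lower x<i) isARec-lower isCycMin≡
           (lcross≡ x<i) (lnest≡ x<i)
           (refl {x = ucross σ i}) (refl {x = unest σ i}) (refl {x = psnestAt σ i}) ⟩
    factor (not (mem i xs)) (mem i xs) true false false false (lnestTail i x xs ≡ᵇ 0) (x ≡ᵇ pathStart (suc i) xs i)
      (lcrossTail i x xs) (lnestTail i x xs) (ucross σ i) (unest σ i) (psnestAt σ i)
      ≈⟨ factor-lower (mem i xs) (lnestTail i x xs ≡ᵇ 0) (lcrossTail i x xs) (lnestTail i x xs)
           (ucross σ i) (unest σ i) (psnestAt σ i) (x ≡ᵇ pathStart (suc i) xs i) ⟩
    _ ≡⟨ headWeight-lower i x xs (<⇒<ᵇ≡true x<i) refl refl refl refl ⟨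
    headWeight i x xs ∎
    where open Factor {pre = pre} {x} {xs} perm
  ... | tri≈ _ x≡i _ = begin
    vertexFactor σ i
      ≡⟨ factor-≡ (trans posOf-< (after-not-before i (cong (_∨ mem i xs) (trans (cong (i ≡ᵇ_) x≡i) (≡ᵇ-refl i)))))
           posOf-i
           (trans (cong (_<ᵇ i) at-i) x≮i) (trans (cong (i <ᵇ_) at-i) i≮x)
           (trans (cong (_≡ᵇ i) at-i) (trans (cong (_≡ᵇ i) x≡i) (≡ᵇ-refl i)))
           (refl {x = isRec σ i}) (refl {x = isARec σ i}) isCycMin≡ (refl {x = lcross σ i}) (refl {x = lnest σ i})
           (refl {x = ucross σ i}) (refl {x = unest σ i}) (psnestAt≡ (ℕₚ.≤-reflexive x≡i)) ⟩
    factor false false false false true (isRec σ i) (isARec σ i) (x ≡ᵇ pathStart (suc i) xs i)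
      (lcross σ i) (lnest σ i) (ucross σ i) (unest σ i) (gaps i xs)
      ≈⟨ factor-fix (isRec σ i) (isARec σ i) (lcross σ i) (lnest σ i) (ucross σ i) (unest σ i) (gaps i xs)
           (x ≡ᵇ pathStart (suc i) xs i) ⟩
    _ ≡⟨ headWeight-fix i x xs x≮i i≮x refl refl ⟨
    headWeight i x xs ∎
    where
    open Factor {pre = pre} {x} {xs} perm
    x≮i : (x <ᵇ i) ≡ false
    x≮i = ≥⇒<ᵇ≡false (ℕₚ.≤-reflexive (sym x≡i))
    i≮x : (i <ᵇ x) ≡ false
    i≮x = ≥⇒<ᵇ≡false (ℕₚ.≤-reflexive x≡i)
    posOf-i : (i <ᵇ posOf i σ) ≡ false
    posOf-i = ≥⇒<ᵇ≡false (subst (_≤ i) (sym (posOf-++ʳ {i} pre (x ∷ xs) (after-not-before i (cong (_∨ mem i xs) (trans (cong (i ≡ᵇ_) x≡i) (≡ᵇ-refl i))))))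
      (subst (λ b → m ℕ.+ (if b then 1 else suc (posOf i xs)) ≤ i) (sym (trans (cong (_≡ᵇ i) x≡i) (≡ᵇ-refl i))) (ℕₚ.≤-reflexive (ℕₚ.+-comm m 1))))
  ... | tri> _ x≢i i<x = begin
    vertexFactor σ i
      ≡⟨ factor-≡ (trans posOf-< (hit-not-before x≢i)) (posOf-> x≢i)
           (trans (cong (_<ᵇ i) at-i) (≥⇒<ᵇ≡false (ℕₚ.<⇒≤ i<x))) (trans (cong (i <ᵇ_) at-i) (<⇒<ᵇ≡true i<x))
           (trans (cong (_≡ᵇ i) at-i) (≢⇒≡ᵇ≡false x≢i)) (isRec-upper i<x) (isARec-upper i<x) isCycMin≡
           (refl {x = lcross σ i}) (refl {x = lnest σ i}) (ucross≡ i<x) (unest≡ i<x) (refl {x = psnestAt σ i}) ⟩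
    factor (not (mem i xs)) (mem i xs) false true false (unestTail i x xs ≡ᵇ 0) false (x ≡ᵇ pathStart (suc i) xs i)
      (lcross σ i) (lnest σ i) (ucrossTail i x xs) (unestTail i x xs) (psnestAt σ i)
      ≈⟨ factor-upper (mem i xs) (unestTail i x xs ≡ᵇ 0) (lcross σ i) (lnest σ i)
           (ucrossTail i x xs) (unestTail i x xs) (psnestAt σ i) (x ≡ᵇ pathStart (suc i) xs i) ⟩
    _ ≡⟨ headWeight-upper i x xs (≥⇒<ᵇ≡false (ℕₚ.<⇒≤ i<x)) (<⇒<ᵇ≡true i<x) refl refl refl refl ⟨
    headWeight i x xs ∎
    where open Factor {pre = pre} {x} {xs} perm

  pow-Σℕ : ∀ x n g → pow x (Σℕ n g) ≈ Π# n (pow x ∘ g)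
  pow-Σℕ x zero g = ≈-refl
  pow-Σℕ x (suc n) g = ≈-trans (pow-+ x (g 0) _) (*-congˡ (pow-Σℕ x n (g ∘ suc)))

  pow-if : ∀ x b a → pow x (if b then a else 0) ≡ (if b then pow x a else 1#)
  pow-if x true a = refl
  pow-if x false a = refl

  pow-count : ∀ x (p : ℕ → Bool) n → pow x (count p (range n)) ≈ Π# n (λ v → if p (suc v) then x else 1#)
  pow-count x p n = ≈-trans (reflexive (cong (pow x) (count-range p n)))
    (≈-trans (pow-Σℕ x n (bit ∘ p ∘ suc)) (Π#-cong n λ v _ → pow-bit (p (suc v))))
    where
    pow-bit : ∀ b → pow x (bit b) ≈ (if b then x else 1#)
    pow-bit true = *-identityʳ x
    pow-bit false = ≈-refl

  pow-sumOver : ∀ x σ (p : ℕ → Bool) f →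
    pow x (sumOver σ p f) ≈ Π# (length σ) (λ v → if p (suc v) then pow x (f (suc v)) else 1#)
  pow-sumOver x σ p f = ≈-trans
    (reflexive (cong (pow x) (Σℕ-range (length σ) λ v → if p v then f v else 0)))
    (≈-trans (pow-Σℕ x (length σ) _) (Π#-cong (length σ) λ v _ → reflexive (pow-if x (p (suc v)) (f (suc v)))))

  sum-filterB : ∀ (p : ℕ → Bool) (f : ℕ → ℕ) xs → foldr (λ i a → f i ℕ.+ a) 0 (filterB p xs)
    ≡ foldr (λ i a → (if p i then f i else 0) ℕ.+ a) 0 xs
  sum-filterB p f [] = refl
  sum-filterB p f (x ∷ xs) with p x
  ... | true  = cong (f x ℕ.+_) (sum-filterB p f xs)
  ... | false = sum-filterB p f xs

  prod-filterB : ∀ (p : ℕ → Bool) (f : ℕ → Carrier) xs → prodL (map f (filterB p xs))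
    ≈ foldr (λ i a → (if p i then f i else 1#) * a) 1# xs
  prod-filterB p f [] = ≈-refl
  prod-filterB p f (x ∷ xs) with p x
  ... | true  = *-congˡ (prod-filterB p f xs)
  ... | false = ≈-trans (prod-filterB p f xs) (≈-sym (*-identityˡ _))

  -- The factors of `factor` stand in the order of those of `weight`, so that the products over
  -- positions merge one after another.
  weight≈Π# : ∀ σ → weight V σ ≈ Π# (length σ) (λ v → vertexFactor σ (suc v))
  weight≈Π# σ =
    cnt# x₁ (λ i → isCPeak σ i ∧ isEARec σ i) ⊛
    cnt# x₂ (λ i → isCDFall σ i ∧ isEARec σ i) ⊛
    cnt# y₁ (λ i → isCVal σ i ∧ isERec σ i) ⊛
    cnt# y₂ (λ i → isCDRise σ i ∧ isERec σ i) ⊛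
    cnt# u₁ (λ i → isCPeak σ i ∧ isNeither σ i) ⊛
    cnt# u₂ (λ i → isCDFall σ i ∧ isNeither σ i) ⊛
    cnt# v₁ (λ i → isCVal σ i ∧ isNeither σ i) ⊛
    cnt# v₂ (λ i → isCDRise σ i ∧ isNeither σ i) ⊛
    ≈-trans (prod-filterB (isFix σ) (w ∘ psnestAt σ) (range n))
      (reflexive (Π#-range n (λ i → if isFix σ i then w (psnestAt σ i) else 1#))) ⊛
    pow-sumOver p₊₁ σ (isCVal σ) (ucross σ) ⊛
    pow-sumOver p₊₂ σ (isCDRise σ) (ucross σ) ⊛
    pow-sumOver p₋₁ σ (isCPeak σ) (lcross σ) ⊛
    pow-sumOver p₋₂ σ (isCDFall σ) (lcross σ) ⊛
    pow-sumOver q₊₁ σ (isCVal σ) (unest σ) ⊛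
    pow-sumOver q₊₂ σ (isCDRise σ) (unest σ) ⊛
    pow-sumOver q₋₁ σ (isCPeak σ) (lnest σ) ⊛
    pow-sumOver q₋₂ σ (isCDFall σ) (lnest σ) ⊛
    ≈-trans (reflexive (cong (pow s) (sum-filterB (isFix σ) (psnestAt σ) (range n)))) (pow-sumOver s σ (isFix σ) (psnestAt σ)) ⊛
    cnt# lam (isCycMin σ)
    where
    n = length σ
    cnt# : ∀ x (p : ℕ → Bool) → pow x (count p (range n)) ≈ Π# n (λ v → if p (suc v) then x else 1#)
    cnt# x p = pow-count x p n
    infixl 7 _⊛_
    _⊛_ : ∀ {x y f g} → x ≈ Π# n f → y ≈ Π# n g → x * y ≈ Π# n (λ v → f v * g v)
    e ⊛ e′ = ≈-trans (*-cong e e′) (≈-sym (Π#-* n _ _))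

  -- The prefix is arbitrary because the induction moves letters from the suffix into it, while the
  -- permutation on which the statistics are evaluated stays the same.
  Π#≈wordWeight : ∀ {n} pre suf → IsPerm n (pre ++ suf) →
    Π# (length suf) (λ t → vertexFactor (pre ++ suf) (suc (length pre ℕ.+ t))) ≈ wordWeight (length pre) suf
  Π#≈wordWeight pre [] perm = ≈-refl
  Π#≈wordWeight {n} pre (x ∷ xs) perm = *-cong
    (≈-trans (reflexive (cong (vertexFactor (pre ++ x ∷ xs) ∘ suc) (ℕₚ.+-identityʳ (length pre))))
             (vertexFactor≈headWeight pre x xs perm))
    (≈-trans (Π#-cong (length xs) λ t _ → reflexive (cong₂ (λ σ j → vertexFactor σ (suc j)) (sym assoc′)
               (trans (ℕₚ.+-suc (length pre) t) (cong (ℕ._+ t) (sym length′)))))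
      (≈-trans (Π#≈wordWeight (pre ++ x ∷ []) xs (subst (IsPerm n) (sym assoc′) perm))
        (reflexive (cong (λ j → wordWeight j xs) length′))))
    where
    assoc′ : (pre ++ x ∷ []) ++ xs ≡ pre ++ x ∷ xs
    assoc′ = Lₚ.++-assoc pre (x ∷ []) xs
    length′ : length (pre ++ x ∷ []) ≡ suc (length pre)
    length′ = trans (Lₚ.length-++ pre) (ℕₚ.+-comm (length pre) 1)

  sumL-filterB : ∀ (p : List ℕ → Bool) (F : List ℕ → Carrier) ws →
    sumL (map F (filterB p ws)) ≈ sumL (map (λ w → ⟦ p w ⟧ F w) ws)
  sumL-filterB p F [] = ≈-refl
  sumL-filterB p F (w ∷ ws) with p w
  ... | true  = +-congˡ (sumL-filterB p F ws)
  ... | false = ≈-trans (sumL-filterB p F ws) (≈-sym (+-identityˡ _))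

  sumL-++ : ∀ xs ys → sumL (xs ++ ys) ≈ sumL xs + sumL ys
  sumL-++ [] ys = ≈-sym (+-identityˡ _)
  sumL-++ (x ∷ xs) ys = ≈-trans (+-congˡ (sumL-++ xs ys)) (≈-sym (+-assoc _ _ _))

  sumL-concatMap : ∀ (F : List ℕ → Carrier) (g : ℕ → List (List ℕ)) vs →
    sumL (map F (concatMap g vs)) ≈ foldr (λ v a → sumL (map F (g v)) + a) 0# vs
  sumL-concatMap F g [] = ≈-refl
  sumL-concatMap F g (v ∷ vs) = ≈-trans (reflexive (cong sumL (Lₚ.map-++ F (g v) _)))
    (≈-trans (sumL-++ (map F (g v)) _) (+-congˡ (sumL-concatMap F g vs)))

  sumL-words : ∀ n k (F : List ℕ → Carrier) → sumL (map F (words n k)) ≈ ΣW n k F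
  sumL-words n zero F = +-identityʳ _
  sumL-words n (suc k) F = ≈-trans (sumL-concatMap F (λ v → map (v ∷_) (words n k)) (range n))
    (≈-trans (reflexive (Σ#-range n _)) (Σ#-cong n λ a _ → ≈-trans
      (reflexive (cong sumL (sym (Lₚ.map-∘ (words n k))))) (sumL-words n k (F ∘ (suc a ∷_)))))

  Qhat≈goodSum : ∀ n → Qhat V n ≈ goodSum n 0
  Qhat≈goodSum n = ≈-trans (sumL-filterB distinctB (weight V) (words n n))
    (≈-trans (sumL-words n n (λ w → ⟦ distinctB w ⟧ weight V w)) (ΣW-cong n n λ σ l r →
      ≈-trans (⟦⟧-cong (distinctB σ) λ d → ≈-trans (weight≈Π# σ)
        (Π#≈wordWeight [] σ record { length≡ = l ; inRange = r ; distinct = d }))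
        (reflexive (cong (λ b → ⟦ b ⟧ wordWeight 0 σ) (sym (𝔹ₚ.∧-identityʳ (distinctB σ)))))))

theorem3p2 : ∀ {c ℓ : Level} (R : CommutativeRing c ℓ) →
    (V : RingDefs.Vars R) →
    CommutativeRing._≈_ R (RingDefs.Vars.v₁ V) (RingDefs.Vars.y₁ V) →
    CommutativeRing._≈_ R (RingDefs.Vars.q₊₁ V) (RingDefs.Vars.p₊₁ V) →
    (n : ℕ) →
    CommutativeRing._≈_ R (RingDefs.Qhat R V n)
    (RingDefs.Jcoef R (RingDefs.γ R V) (RingDefs.β R V) n 0)
theorem3p2 R V v₁≈y₁ q₊₁≈p₊₁ n = ≈-trans (Qhat≈goodSum n)
  -- The initial values hold because the empty word contains 1, ..., m only for m = 0. At height 0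
  -- `descent` is the J-fraction itself.
  (S≈descent (γ V) (β V) peakWeight valleyWeight β≈ goodSum ≈-refl (λ _ → ≈-refl)
    (λ k → ≈-trans (goodSum-step-0 v₁≈y₁ q₊₁≈p₊₁ k) (+-congʳ (*-congʳ (level≈γ 0))))
    (λ k m → ≈-trans (goodSum-step v₁≈y₁ q₊₁≈p₊₁ k m) (+-congʳ (+-congʳ (*-congʳ (level≈γ (suc m))))))
    n 0)
  where
  open CommutativeRing R
    using (_≈_; _+_; _*_; +-cong; +-congʳ; *-congʳ; *-congˡ; commutativeSemiring)
    renaming (refl to ≈-refl; sym to ≈-sym; trans to ≈-trans)
  open RingDefs R
  open Vars V
  open Words R using (Σ#-arcWeight)
  open Scan R V
  open JFraction R
  open Factorisation R V
  open import Algebra.Solver.Ring.NaturalCoefficients.Default commutativeSemiring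
    using (solve; _:+_; _:*_; _:=_; con)

  level≈γ : ∀ m → levelWeight m ≈ γ V m
  level≈γ zero = solve 2 (λ W L → con 0 :+ con 0 :+ W :* con 1 :* L := L :* W) ≈-refl (w 0) lam
  level≈γ (suc m) = +-cong (+-cong (Σ#-arcWeight x₂ u₂ p₋₂ q₋₂ m) (Σ#-arcWeight y₂ v₂ p₊₂ q₊₂ m))
    (solve 3 (λ W S L → W :* S :* L := L :* S :* W) ≈-refl (w (suc m)) (pow s (suc m)) lam)

  β≈ : ∀ m → β V (suc m) ≈ valleyWeight m * peakWeight m
  β≈ m = ≈-trans
    (solve 4 (λ L A P Y → L :* A :* P :* Y := L :* (P :* Y) :* A) ≈-refl
      (lam + fromℕ m) (pow p₋₁ m * x₁ + q₋₁ * qint p₋₁ q₋₁ m * u₁) (pow p₊₁ m) y₁)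
    (*-congˡ (≈-sym (Σ#-arcWeight x₁ u₁ p₋₁ q₋₁ m)))
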